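{- Let $\phi_{\mathbb{Z}[i]}$ be the minimal Euclidean function on $\mathbb{Z}[i]$. For every integer $k\ge1$, \[|\phi_{\mathbb{Z}[i]}^{ -1}(2k)|=14\cdot 4^k-14\cdot 2^k+4\quad\text{and}\quad |\phi_{\mathbb{Z}[i]}^{ -1}(2k+1)|=28\cdot 4^k-20\cdot 2^k+4.\]
   Context: For $M\subseteq\mathbb{Z}[i]$ and $\beta\in\mathbb{Z}[i]$, write $M\twoheadrightarrow \mathbb{Z}[i]/\beta$ if every residue class of $\mathbb{Z}[i]/(\beta)$ has a representative in $M$. The Motzkin sets are $A_{\mathbb{Z}[i],0}=\{0,\pm1,\pm i\}$ and, for $j\ge1$, $A_{\mathbb{Z}[i],j}=A_{\mathbb{Z}[i],j-1}\cup\{\beta: A_{\mathbb{Z}[i],j-1}\twoheadrightarrow\mathbb{Z}[i]/\beta\}$. The minimal Euclidean function $\phi_{\mathbb{Z}[i]}:\mathbb{Z}[i]\setminus 0\to\mathbb{N}$ is $\phi_{\mathbb{Z}[i]}(a)=j$ where $j$ is least with $a\in A_{\mathbb{Z}[i],j}$. -}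

module Defs where

open import Data.Integer using (ℤ; +_; -_; _+_; _-_; _*_; _^_)
open import Data.Nat using (ℕ; zero; suc; _<_)
open import Data.Product using (_×_; _,_; ∃; ∃-syntax)
open import Data.Sum using (_⊎_)
open import Data.List using (List; length)
open import Data.List.Membership.Propositional using (_∈_)
open import Data.List.Relation.Unary.Unique.Propositional using (Unique)
open import Relation.Binary.PropositionalEquality using (_≡_; _≢_)
open import Relation.Nullary using (¬_)

record ℤ[i] : Set where
  constructor _+_i
  field
    re : ℤ
    im : ℤ
open ℤ[i] public

0ᵍ : ℤ[i]
0ᵍ = (+ 0) + (+ 0) i

_-ᵍ_ : ℤ[i] → ℤ[i] → ℤ[i]
(a + b i) -ᵍ (c + d i) = (a - c) + (b - d) i

_*ᵍ_ : ℤ[i] → ℤ[i] → ℤ[i]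
(a + b i) *ᵍ (c + d i) = (a * c - b * d) + (a * d + b * c) i

_∣ᵍ_ : ℤ[i] → ℤ[i] → Set
β ∣ᵍ γ = ∃[ q ] (β *ᵍ q ≡ γ)

_↠mod_ : (ℤ[i] → Set) → ℤ[i] → Set
M ↠mod β = ∀ (x : ℤ[i]) → ∃[ m ] (M m × β ∣ᵍ (x -ᵍ m))

data A₀ : ℤ[i] → Set where
  zero∈ : A₀ ((+ 0) + (+ 0) i)
  one∈  : A₀ ((+ 1) + (+ 0) i)
  mone∈ : A₀ ((- (+ 1)) + (+ 0) i)
  i∈    : A₀ ((+ 0) + (+ 1) i)
  mi∈   : A₀ ((+ 0) + (- (+ 1)) i)

Motzkin : ℕ → ℤ[i] → Set
Motzkin zero    a = A₀ a
Motzkin (suc j) β = Motzkin j β ⊎ (Motzkin j ↠mod β)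

φ≡ : ℤ[i] → ℕ → Set
φ≡ a n = a ≢ 0ᵍ × Motzkin n a × (∀ j → j < n → ¬ Motzkin j a)

HasCard : (ℤ[i] → Set) → ℕ → Set
HasCard S c = ∃[ L ] (Unique L × (∀ a → (a ∈ L → S a) × (S a → a ∈ L)) × length L ≡ c)

PreimageCard : ℕ → ℤ → Set
PreimageCard n c = ∃[ m ] (HasCard (λ a → φ≡ a n) m × + m ≡ c)

{-# OPTIONS --safe #-}
module Submission where

-- Put w₂ₖ = 3·2ᵏ, w₂ₖ₊₁ = 4·2ᵏ, and let Dₙ be the set of x + y i with x + y odd in the octagon
-- |x|, |y| ≤ wₙ - 2, |x| + |y| ≤ wₙ₊₁ - 3. The n-th Motzkin set is Tₙ = {0} ∪ ⋃ⱼ (1 + i)ʲ Dₙ₋ⱼ.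
--
-- Tₙ covers ℤ[i]/β for 0 ≠ β ∈ Tₙ₊₁: a representative in the fundamental square centred at 0
-- misses the octagon at most on its diagonal sides. If it is odd, it lies in Dₙ. If it and β
-- are even, divide by 1 + i. If it is even and β is odd, then it is far enough from the boundary
-- to lie in Tₙ, or subtracting a suitable unit multiple of β yields an element of Dₙ.
-- Conversely, if β is odd and outside the octagon, the lattice points next to β (1 + i) / 2
-- have no representative in Tₙ; if β = (1 + i) γ, a representative of γ is a multiple of γ by
-- an odd factor, so γ lies in the n-th Motzkin set.
--
-- Multiplication by powers of 1 + i identifies Dₙ with the preimage of n, and the coordinates
-- u = (x + y - 1) / 2, v = (x - y - 1) / 2 turn Dₙ into a square with four triangular corners
-- removed, which is easy to count.

open import Defs
open import Data.Bool using (if_then_else_)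
open import Data.Empty using (⊥-elim)
open import Data.Integer hiding (suc)
import Data.Integer.DivMod as DivMod
open import Data.Integer.Properties
open import Data.Integer.Tactic.RingSolver using (solve; solve-∀)
open import Data.List using (List; []; _∷_; length; map; _++_)
open import Data.List.Membership.Propositional using (_∈_)
open import Data.List.Membership.Propositional.Properties using (∈-map⁺; ∈-map⁻; ∈-++⁺ˡ; ∈-++⁺ʳ; ∈-++⁻)
open import Data.List.Properties using (length-map; length-++)
open import Data.List.Relation.Unary.All as All using (All)
open import Data.List.Relation.Unary.AllPairs using ([]; _∷_)
open import Data.List.Relation.Unary.Any using (here; there)
open import Data.List.Relation.Unary.Unique.Propositional using (Unique)
open import Data.List.Relation.Unary.Unique.Propositional.Properties using (map⁺; ++⁺)
open import Data.Nat as ℕ using (ℕ; zero; suc)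
import Data.Nat.Properties as ℕP
open import Data.Nat.Tactic.RingSolver using () renaming (solve to ℕ-solve)
open import Data.Product using (_×_; _,_; proj₁; proj₂; ∃; ∃-syntax)
open import Data.Sum using (_⊎_; inj₁; inj₂; [_,_]′)
open import Function using (_∘_)
open import Relation.Binary.PropositionalEquality
open import Relation.Nullary using (¬_; yes; no)
open import Relation.Nullary.Decidable using (Dec; map′; _×-dec_; does; toSum; dec-true; dec-false)

-- A linear consequence of an inequality a ≤ b is certified by a ring identity;
-- the second version also rounds, since it bounds 2 (y - x) below by -1.
lin : ∀ {x y a b} k → a ≤ b → y - x ≡ b - a + + k → x ≤ y
lin k h e = 0≤i-j⇒j≤i (subst (0ℤ ≤_) (sym e) (+-mono-≤ (i≤j⇒0≤j-i h) (+≤+ {0} {k} ℕ.z≤n)))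

lin₂ : ∀ {x y a b} k → a ≤ b → (y - x) + (y - x) + + 1 ≡ b - a + + k → x ≤ y
lin₂ {x} {y} {a} {b} k h e with x ≤? y
... | yes x≤y = x≤y
... | no  x≰y = ⊥-elim (absurd (lin {x = 0ℤ} {y = - (+ 1)} k (+-mono-≤ h (+-mono-≤ y<x y<x)) (certificate x y k a b e)))
  where
  y<x : y + + 1 ≤ x
  y<x = subst (_≤ x) (+-comm (+ 1) y) (i<j⇒suc[i]≤j (≰⇒> x≰y))
  absurd : ¬ (0ℤ ≤ - (+ 1))
  absurd ()
  certificate : ∀ x y k a b → (y - x) + (y - x) + + 1 ≡ b - a + + k →
                - (+ 1) - 0ℤ ≡ (b + (x + x)) - (a + (y + + 1 + (y + + 1))) + + k
  certificate x y k a b e =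
    trans (rearrange x y) (trans (cong (λ t → t + ((x + x) - (y + + 1 + (y + + 1)))) e) (rearrange′ a b x y (+ k)))
    where
    rearrange : ∀ x y → - (+ 1) - 0ℤ ≡ (y - x) + (y - x) + + 1 + ((x + x) - (y + + 1 + (y + + 1)))
    rearrange = solve-∀
    rearrange′ : ∀ a b x y k → b - a + k + ((x + x) - (y + + 1 + (y + + 1))) ≡ (b + (x + x)) - (a + (y + + 1 + (y + + 1))) + k
    rearrange′ = solve-∀

infixl 6 _⊕_
_⊕_ : ∀ {a b c d} → a ≤ b → c ≤ d → a + c ≤ b + d
_⊕_ = +-mono-≤

j+1≰j : ∀ {j} → ¬ (j + + 1 ≤ j)
j+1≰j {j} h with +≤+ () ← lin {+ 1} {+ 0} 0 h (solve (j ∷ []))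

compare : ∀ x y → x ≤ y ⊎ y + + 1 ≤ x
compare x y with x ≤? y
... | yes x≤y = inj₁ x≤y
... | no  x≰y = inj₂ (subst (_≤ x) (+-comm (+ 1) y) (i<j⇒suc[i]≤j (≰⇒> x≰y)))

-- Parity

data Parity (x : ℤ) : Set where
  even : ∀ h → x ≡ h + h → Parity x
  odd  : ∀ h → x ≡ h + h + + 1 → Parity x

shift-parity : ∀ {x} → Parity x → Parity (x + + 1)
shift-parity (even h refl) = odd h refl
shift-parity (odd  h refl) = even (h + + 1) (solve (h ∷ []))

neg-parity : ∀ {x} → Parity x → Parity (- x)
neg-parity (even h refl) = even (- h) (solve (h ∷ []))
neg-parity (odd  h refl) = odd (- h - + 1) (solve (h ∷ []))

parity : ∀ x → Parity x
parity (+ n)    = go n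
  where
  go : ∀ n → Parity (+ n)
  go zero    = even 0ℤ refl
  go (suc n) = subst Parity (+-comm (+ n) (+ 1)) (shift-parity (go n))
parity -[1+ n ] = neg-parity (parity (+ suc n))

even≢odd : ∀ h g → h + h ≢ g + g + + 1
even≢odd h g e = j+1≰j {h} (≤-trans (+-monoˡ-≤ (+ 1) h≤g) g+1≤h)
  where
  h≤g : h ≤ g
  h≤g = lin₂ 0 (≤-reflexive e) (solve (h ∷ g ∷ []))
  g+1≤h : g + + 1 ≤ h
  g+1≤h = lin₂ 0 (≤-reflexive (sym e)) (solve (h ∷ g ∷ []))

Even Odd : ℤ[i] → Set
Even (x + y i) = ∃[ h ] x + y ≡ h + h
Odd  (x + y i) = ∃[ h ] x + y ≡ h + h + + 1

even⊎odd : ∀ z → Even z ⊎ Odd z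
even⊎odd (x + y i) with parity (x + y)
... | even h e = inj₁ (h , e)
... | odd  h e = inj₂ (h , e)

¬even×odd : ∀ {z} → Even z → ¬ Odd z
¬even×odd {x + y i} (h , e) (g , f) = even≢odd h g (trans (sym e) f)

-- Symmetries of the square lattice

-- `rot` is multiplication by i and `twist` is multiplication by 1 + i.
rot conj twist : ℤ[i] → ℤ[i]
rot   (x + y i) = (- y) + x i
conj  (x + y i) = x + (- y) i
twist (x + y i) = (x - y) + (x + y) i

infix 4 _≡ᵍ_
_≡ᵍ_ : ∀ {x y u v} → x ≡ u → y ≡ v → (x + y i) ≡ (u + v i)
_≡ᵍ_ = cong₂ _+_i

twist-rot : ∀ z → twist (rot z) ≡ rot (twist z)
twist-rot (x + y i) = real x y ≡ᵍ imag x y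
  where
  real : ∀ x y → - y - x ≡ - (x + y)
  real = solve-∀
  imag : ∀ x y → - y + x ≡ x - y
  imag = solve-∀

-- Conjugation sends 1 + i to -i (1 + i); the factor -i is the three quarter turns.
twist-conj : ∀ z → twist (rot (rot (rot (conj z)))) ≡ conj (twist z)
twist-conj (x + y i) = real x y ≡ᵍ imag x y
  where
  real : ∀ x y → - - - y - - x ≡ x - y
  real = solve-∀
  imag : ∀ x y → - - - y + - x ≡ - (x + y)
  imag = solve-∀

rot⁴ : ∀ z → rot (rot (rot (rot z))) ≡ z
rot⁴ (x + y i) = neg-involutive x ≡ᵍ neg-involutive y

conj² : ∀ z → conj (conj z) ≡ z
conj² (x + y i) = refl ≡ᵍ neg-involutive y

-- The quarter turns of the cone |y| ≤ x cover the plane, so a property that can be pulled back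
-- along `rot` needs checking only there.
sector : (P : ℤ[i] → Set) → (∀ z → P (rot z) → P z) →
         (∀ x y → y ≤ x → - x ≤ y → P (x + y i)) → ∀ z → P z
sector P unrot base (x + y i) with ≤-total x y | ≤-total (- x) y
... | inj₂ y≤x | inj₁ -x≤y = base x y y≤x -x≤y
... | inj₂ y≤x | inj₂ y≤-x = unrot _ (base (- y) x (lin 0 y≤-x (solve (x ∷ y ∷ []))) (lin 0 y≤x (solve (x ∷ y ∷ []))))
... | inj₁ x≤y | inj₂ y≤-x = unrot _ (unrot _ (base (- x) (- y) (lin 0 x≤y (solve (x ∷ y ∷ []))) (lin 0 y≤-x (solve (x ∷ y ∷ [])))))
... | inj₁ x≤y | inj₁ -x≤y = unrot _ (unrot _ (unrot _ (base (- - y) (- x) (lin 0 -x≤y (solve (x ∷ y ∷ []))) (lin 0 x≤y (solve (x ∷ y ∷ []))))))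

octant : (P : ℤ[i] → Set) → (∀ z → P (rot z) → P z) → (∀ z → P (conj z) → P z) →
         (∀ x y → 0ℤ ≤ y → y ≤ x → P (x + y i)) → ∀ z → P z
octant P unrot unconj base = sector P unrot half
  where
  half : ∀ x y → y ≤ x → - x ≤ y → P (x + y i)
  half x y y≤x -x≤y with ≤-total 0ℤ y
  ... | inj₁ 0≤y = base x y 0≤y y≤x
  ... | inj₂ y≤0 = unconj _ (base x (- y) (lin 0 y≤0 (solve (y ∷ []))) (lin 0 -x≤y (solve (x ∷ y ∷ []))))

-- Octagons

record Octagon (m s x y : ℤ) : Set where
  constructor octagon
  field
    x≤    : x ≤ m
    -x≤   : - x ≤ m
    y≤    : y ≤ m
    -y≤   : - y ≤ m
    x+y≤  : x + y ≤ s
    x-y≤  : x - y ≤ s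
    -x+y≤ : - x + y ≤ s
    -x-y≤ : - x - y ≤ s
open Octagon public

InOctagon : ℤ → ℤ → ℤ[i] → Set
InOctagon m s (x + y i) = Octagon m s x y

octagon-rot : ∀ {m s} x y → Octagon m s x y → Octagon m s (- y) x
octagon-rot {m} {s} x y o = record
  { x≤ = -y≤ o ; -x≤ = lin 0 (y≤ o) (solve (m ∷ y ∷ [])) ; y≤ = x≤ o ; -y≤ = -x≤ o
  ; x+y≤ = lin 0 (x-y≤ o) (solve (x ∷ y ∷ s ∷ [])) ; x-y≤ = lin 0 (-x-y≤ o) (solve (x ∷ y ∷ s ∷ []))
  ; -x+y≤ = lin 0 (x+y≤ o) (solve (x ∷ y ∷ s ∷ [])) ; -x-y≤ = lin 0 (-x+y≤ o) (solve (x ∷ y ∷ s ∷ [])) }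

octagon-conj : ∀ {m s} x y → Octagon m s x y → Octagon m s x (- y)
octagon-conj {m} {s} x y o = record
  { x≤ = x≤ o ; -x≤ = -x≤ o ; y≤ = -y≤ o ; -y≤ = lin 0 (y≤ o) (solve (m ∷ y ∷ []))
  ; x+y≤ = x-y≤ o ; x-y≤ = lin 0 (x+y≤ o) (solve (x ∷ y ∷ s ∷ []))
  ; -x+y≤ = -x-y≤ o ; -x-y≤ = lin 0 (-x+y≤ o) (solve (x ∷ y ∷ s ∷ [])) }

rot-octagon : ∀ {m s} z → InOctagon m s z → InOctagon m s (rot z)
rot-octagon (x + y i) = octagon-rot x y

conj-octagon : ∀ {m s} z → InOctagon m s z → InOctagon m s (conj z)
conj-octagon (x + y i) = octagon-conj x y

unrot-octagon : ∀ {m s} z → InOctagon m s (rot z) → InOctagon m s z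
unrot-octagon z o = subst (InOctagon _ _) (rot⁴ z) (rot-octagon _ (rot-octagon _ (rot-octagon _ o)))

unconj-octagon : ∀ {m s} z → InOctagon m s (conj z) → InOctagon m s z
unconj-octagon z o = subst (InOctagon _ _) (conj² z) (conj-octagon _ o)

-- Where 0 ≤ y ≤ x, the largest axis form is x and the largest diagonal form is x + y, so two of the
-- eight inequalities imply the others.
octant-octagon : ∀ {m s} x y → 0ℤ ≤ y → y ≤ x → x ≤ m → x + y ≤ s → Octagon m s x y
octant-octagon {m} {s} x y 0≤y y≤x x≤m x+y≤s = record
  { x≤ = x≤m ; -x≤ = lin 0 (0≤y ⊕ 0≤y ⊕ y≤x ⊕ y≤x ⊕ x≤m) (solve (x ∷ y ∷ m ∷ []))
  ; y≤ = lin 0 (y≤x ⊕ x≤m) (solve (x ∷ y ∷ m ∷ []))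
  ; -y≤ = lin 0 (0≤y ⊕ 0≤y ⊕ y≤x ⊕ x≤m) (solve (x ∷ y ∷ m ∷ []))
  ; x+y≤ = x+y≤s
  ; x-y≤ = lin 0 (0≤y ⊕ 0≤y ⊕ x+y≤s) (solve (x ∷ y ∷ s ∷ []))
  ; -x+y≤ = lin 0 (0≤y ⊕ 0≤y ⊕ y≤x ⊕ y≤x ⊕ x+y≤s) (solve (x ∷ y ∷ s ∷ []))
  ; -x-y≤ = lin 0 (0≤y ⊕ 0≤y ⊕ 0≤y ⊕ 0≤y ⊕ y≤x ⊕ y≤x ⊕ x+y≤s) (solve (x ∷ y ∷ s ∷ [])) }

grow-octagon : ∀ {m s m′ s′} z → m ≤ m′ → s ≤ s′ → InOctagon m s z → InOctagon m′ s′ z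
grow-octagon (x + y i) m≤ s≤ o = record
  { x≤ = ≤-trans (x≤ o) m≤ ; -x≤ = ≤-trans (-x≤ o) m≤ ; y≤ = ≤-trans (y≤ o) m≤ ; -y≤ = ≤-trans (-y≤ o) m≤
  ; x+y≤ = ≤-trans (x+y≤ o) s≤ ; x-y≤ = ≤-trans (x-y≤ o) s≤
  ; -x+y≤ = ≤-trans (-x+y≤ o) s≤ ; -x-y≤ = ≤-trans (-x-y≤ o) s≤ }

-- With w₂ₖ = 3·2ᵏ and w₂ₖ₊₁ = 4·2ᵏ, the parameters are q n = wₙ₊₁ - wₙ and 2 p n = 2wₙ - wₙ₊₁,
-- so that wₙ = q n + 2 p n and wₙ₊₁ = 2 q n + 2 p n.
q p : ℕ → ℤ
q zero    = + 1
q (suc n) = p n + p n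
p zero    = + 1
p (suc n) = q n

-- The step from (q, p) to (2 p, q) exchanges the last two bounds, so together these form an
-- invariant of the sequence.
record Admissible (q p : ℤ) : Set where
  field
    1≤p  : + 1 ≤ p
    p≤q  : p ≤ q
    q≤2p : q ≤ p + p
open Admissible

admissible-step : ∀ {q p} → Admissible q p → Admissible (p + p) q
admissible-step adm = record
  { 1≤p = ≤-trans (1≤p adm) (p≤q adm) ; p≤q = q≤2p adm ; q≤2p = +-mono-≤ (p≤q adm) (p≤q adm) }

admissible : ∀ n → Admissible (q n) (p n)
admissible zero    = record { 1≤p = +≤+ (ℕ.s≤s ℕ.z≤n) ; p≤q = +≤+ (ℕ.s≤s ℕ.z≤n) ; q≤2p = +≤+ (ℕ.s≤s ℕ.z≤n) }
admissible (suc n) = admissible-step (admissible n)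

-- At (`q n`, `p n`), `Oct` is the octagon of Dₙ without the parity condition. `Near` relaxes its
-- diagonal bound by one, which is what reduction modulo β yields.
Oct Near : ℤ → ℤ → ℤ[i] → Set
Oct  q p = InOctagon (q + p + p - + 2) (q + q + p + p - + 3)
Near q p = InOctagon (q + p + p - + 2) (q + q + p + p - + 2)

-- The diagonal bound of Near is even, so it is not attained by an odd element.
near-odd⇒oct : ∀ {q p} z → Near q p z → Odd z → Oct q p z
near-odd⇒oct {q} {p} (x + y i) = go x y
  where
  go : ∀ x y → Octagon (q + p + p - + 2) (q + q + p + p - + 2) x y → Odd (x + y i) →
       Octagon (q + p + p - + 2) (q + q + p + p - + 3) x y
  go x y o (h , e) = record
    { x≤ = x≤ o ; -x≤ = -x≤ o ; y≤ = y≤ o ; -y≤ = -y≤ o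
    ; x+y≤  = lin 0 (e≤ ⊕ h₁ ⊕ h₁) (solve (x ∷ y ∷ h ∷ p ∷ q ∷ []))
    ; x-y≤  = lin 0 (e≤ ⊕ h₂ ⊕ h₂) (solve (x ∷ y ∷ h ∷ p ∷ q ∷ []))
    ; -x+y≤ = lin 0 (e≥ ⊕ h₃ ⊕ h₃) (solve (x ∷ y ∷ h ∷ p ∷ q ∷ []))
    ; -x-y≤ = lin 0 (e≥ ⊕ h₄ ⊕ h₄) (solve (x ∷ y ∷ h ∷ p ∷ q ∷ [])) }
    where
    e≤ : x + y ≤ h + h + + 1
    e≤ = ≤-reflexive e
    e≥ : h + h + + 1 ≤ x + y
    e≥ = ≤-reflexive (sym e)
    h₁ : h ≤ q + p - + 2
    h₁ = lin₂ 0 (e≥ ⊕ x+y≤ o) (solve (x ∷ y ∷ h ∷ p ∷ q ∷ []))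
    h₂ : h - y ≤ q + p - + 2
    h₂ = lin₂ 0 (e≥ ⊕ x-y≤ o) (solve (x ∷ y ∷ h ∷ p ∷ q ∷ []))
    h₃ : y - h ≤ q + p - + 1
    h₃ = lin₂ 0 (e≤ ⊕ -x+y≤ o) (solve (x ∷ y ∷ h ∷ p ∷ q ∷ []))
    h₄ : - h ≤ q + p - + 1
    h₄ = lin₂ 0 (e≤ ⊕ -x-y≤ o) (solve (x ∷ y ∷ h ∷ p ∷ q ∷ []))

-- Multiplication by 1 + i exchanges axis and diagonal bounds: the new coordinates are x - y and x +
-- y, the new diagonal forms are 2 x and 2 y up to sign. This fits since wₙ₊₂ = 2 wₙ, with one unit
-- to spare on every side.
twist-oct : ∀ {q p} z → Oct q p z → Oct (p + p) q (twist z)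
twist-oct {q} {p} (x + y i) = go x y
  where
  go : ∀ x y → Octagon (q + p + p - + 2) (q + q + p + p - + 3) x y →
       Octagon (p + p + q + q - + 2) (p + p + (p + p) + q + q - + 3) (x - y) (x + y)
  go x y o = record
    { x≤ = lin 1 (x-y≤ o) (solve (x ∷ y ∷ p ∷ q ∷ [])) ; -x≤ = lin 1 (-x+y≤ o) (solve (x ∷ y ∷ p ∷ q ∷ []))
    ; y≤ = lin 1 (x+y≤ o) (solve (x ∷ y ∷ p ∷ q ∷ [])) ; -y≤ = lin 1 (-x-y≤ o) (solve (x ∷ y ∷ p ∷ q ∷ []))
    ; x+y≤  = lin 1 (x≤ o ⊕ x≤ o) (solve (x ∷ y ∷ p ∷ q ∷ []))
    ; x-y≤  = lin 1 (-y≤ o ⊕ -y≤ o) (solve (x ∷ y ∷ p ∷ q ∷ []))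
    ; -x+y≤ = lin 1 (y≤ o ⊕ y≤ o) (solve (x ∷ y ∷ p ∷ q ∷ []))
    ; -x-y≤ = lin 1 (-x≤ o ⊕ -x≤ o) (solve (x ∷ y ∷ p ∷ q ∷ [])) }

oct-step : ∀ {q p} → Admissible q p → ∀ z → Oct q p z → Oct (p + p) q z
oct-step {q} {p} adm z = grow-octagon z
  (lin 1 (1≤p adm ⊕ p≤q adm) (solve (p ∷ q ∷ [])))
  (lin 2 (1≤p adm ⊕ 1≤p adm) (solve (p ∷ q ∷ [])))

-- The sets Tₙ

rot-odd : ∀ z → Odd z → Odd (rot z)
rot-odd (x + y i) (h , e) = h - y , trans (reflect x y) (trans (cong (λ t → t - y - y) e) (solve (h ∷ y ∷ [])))
  where
  reflect : ∀ x y → - y + x ≡ x + y - y - y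
  reflect = solve-∀

conj-odd : ∀ z → Odd z → Odd (conj z)
conj-odd (x + y i) (h , e) = h - y , trans (reflect x y) (trans (cong (λ t → t - y - y) e) (solve (h ∷ y ∷ [])))
  where
  reflect : ∀ x y → x + - y ≡ x + y - y - y
  reflect = solve-∀

data T : ℕ → ℤ[i] → Set where
  zeroᵗ  : ∀ {n} → T n 0ᵍ
  oddᵗ   : ∀ {n z} → Odd z → Oct (q n) (p n) z → T n z
  twistᵗ : ∀ {n z} → T n z → T (suc n) (twist z)

T-rot : ∀ {n z} → T n z → T n (rot z)
T-rot zeroᵗ               = zeroᵗ
T-rot (oddᵗ {z = z} o h)  = oddᵗ (rot-odd z o) (rot-octagon z h)
T-rot (twistᵗ {z = z} t)  = subst (T _) (twist-rot z) (twistᵗ (T-rot t))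

T-conj : ∀ {n z} → T n z → T n (conj z)
T-conj zeroᵗ               = zeroᵗ
T-conj (oddᵗ {z = z} o h)  = oddᵗ (conj-odd z o) (conj-octagon z h)
T-conj (twistᵗ {z = z} t)  = subst (T _) (twist-conj z) (twistᵗ (T-rot (T-rot (T-rot (T-conj t)))))

T-unrot : ∀ {n} z → T n (rot z) → T n z
T-unrot z t = subst (T _) (rot⁴ z) (T-rot (T-rot (T-rot t)))

T-unconj : ∀ {n} z → T n (conj z) → T n z
T-unconj z t = subst (T _) (conj² z) (T-conj t)

T-suc : ∀ {n z} → T n z → T (suc n) z
T-suc zeroᵗ                 = zeroᵗ
T-suc (oddᵗ {n} {z} o h)    = oddᵗ o (oct-step (admissible n) z h)
T-suc (twistᵗ t)            = twistᵗ (T-suc t)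

zero-oct : ∀ {q p} → Admissible q p → Oct q p 0ᵍ
zero-oct {q} {p} adm = octant-octagon 0ℤ 0ℤ ≤-refl ≤-refl
  (lin 1 (1≤p adm ⊕ 1≤p adm ⊕ 1≤p adm ⊕ p≤q adm) (solve (p ∷ q ∷ [])))
  (lin 1 (1≤p adm ⊕ 1≤p adm ⊕ 1≤p adm ⊕ 1≤p adm ⊕ p≤q adm ⊕ p≤q adm) (solve (p ∷ q ∷ [])))

T⇒oct : ∀ {n z} → T n z → Oct (q n) (p n) z
T⇒oct {n} zeroᵗ          = zero-oct (admissible n)
T⇒oct (oddᵗ _ h)         = h
T⇒oct (twistᵗ {n} {z} t) = twist-oct {q n} {p n} z (T⇒oct t)

-- The two strict bounds add up to the sides of the octagon, as x = y + (x - y) and x + y = 2 y + (x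
-- - y).
inner-odd : ∀ {q p} x y → 0ℤ ≤ y → y ≤ x → y + + 1 ≤ q → x - y + + 1 ≤ p + p → Oct q p (x + y i)
inner-odd {q} {p} x y 0≤y y≤x y<q x-y<2p = octant-octagon x y 0≤y y≤x
  (lin 0 (y<q ⊕ x-y<2p) (solve (x ∷ y ∷ p ∷ q ∷ [])))
  (lin 0 (y<q ⊕ y<q ⊕ x-y<2p) (solve (x ∷ y ∷ p ∷ q ∷ [])))

-- In this smaller region even points belong to Tₙ as well. Dividing an even point by 1 + i and
-- conjugating gives (x + y) / 2 + i (x - y) / 2; this exchanges the conditions y < q and x - y < 2
-- p on passing to the level below.
inner : ∀ n x y → 0ℤ ≤ y → y ≤ x → y + + 1 ≤ q n → x - y + + 1 ≤ p n + p n → T n (x + y i)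
inner n x y 0≤y y≤x y<q x-y<2p with parity (x + y)
inner n x y 0≤y y≤x y<q x-y<2p | odd h e = oddᵗ (h , e) (inner-odd x y 0≤y y≤x y<q x-y<2p)
-- Here q = p = 1 leaves only the points 0 and 1, and 1 is odd.
inner zero x y 0≤y y≤x y<q x-y<2p | even h e = subst (T 0) (sym (x≡0 ≡ᵍ y≡0)) zeroᵗ
  where
  y<1 : y + + 1 ≤ + 1
  y<1 = y<q
  x-y<2 : x - y + + 1 ≤ + 2
  x-y<2 = x-y<2p
  y≡0 : y ≡ 0ℤ
  y≡0 = ≤-antisym (lin 0 y<1 (solve (y ∷ []))) 0≤y
  h≤0 : h ≤ 0ℤ
  h≤0 = lin₂ 0 (≤-reflexive (sym e) ⊕ x-y<2 ⊕ y<1 ⊕ y<1) (solve (h ∷ x ∷ y ∷ []))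
  x≡0 : x ≡ 0ℤ
  x≡0 = ≤-antisym (lin 0 (h≤0 ⊕ h≤0 ⊕ ≤-reflexive e ⊕ 0≤y) (solve (h ∷ x ∷ y ∷ []))) (≤-trans 0≤y y≤x)
inner (suc n) x y 0≤y y≤x y<q x-y<2p | even h e =
  subst (T (suc n)) (re≡ ≡ᵍ im≡)
    (twistᵗ {z = h + (h - x) i} (T-unconj (h + (h - x) i) (subst (λ t → T n (h + t i)) (sym (neg-minus h x))
      (inner n h (x - h) 0≤x-h x-h≤h x-h<q 2h-x<2p))))
  where
  neg-minus : ∀ h x → - (h - x) ≡ x - h
  neg-minus = solve-∀
  re≡ : h - (h - x) ≡ x
  re≡ = solve (h ∷ x ∷ [])
  im≡ : h + (h - x) ≡ y
  im≡ = trans (sym (+-assoc h h (- x))) (trans (cong (_- x) (sym e)) (solve (x ∷ y ∷ [])))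
  0≤x-h : 0ℤ ≤ x - h
  0≤x-h = lin₂ 1 (≤-reflexive (sym e) ⊕ y≤x) (solve (h ∷ x ∷ y ∷ []))
  x-h≤h : x - h ≤ h
  x-h≤h = lin 0 (≤-reflexive e ⊕ 0≤y) (solve (h ∷ x ∷ y ∷ []))
  x-h<q : x - h + + 1 ≤ q n
  x-h<q = go (q n) x-y<2p
    where
    go : ∀ q → x - y + + 1 ≤ q + q → x - h + + 1 ≤ q
    go q le = lin₂ 0 (le ⊕ ≤-reflexive e) (solve (h ∷ x ∷ y ∷ q ∷ []))
  2h-x<2p : h - (x - h) + + 1 ≤ p n + p n
  2h-x<2p = go (p n + p n) y<q
    where
    go : ∀ r → y + + 1 ≤ r → h - (x - h) + + 1 ≤ r
    go r le = lin 0 (le ⊕ ≤-reflexive (sym e)) (solve (h ∷ x ∷ y ∷ r ∷ []))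

unit-octagon : ∀ x y → Octagon (+ 1) (+ 1) x y → A₀ (x + y i)
unit-octagon (+ 0) (+ 0) h = zero∈
unit-octagon (+ 1) (+ 0) h = one∈
unit-octagon (+ 0) (+ 1) h = i∈
unit-octagon -[1+ 0 ] (+ 0) h = mone∈
unit-octagon (+ 0) -[1+ 0 ] h = mi∈
unit-octagon (+ suc (suc _)) _ h with +≤+ (ℕ.s≤s ()) ← x≤ h
unit-octagon -[1+ suc _ ] _ h with +≤+ (ℕ.s≤s ()) ← -x≤ h
unit-octagon (+ 0) (+ suc (suc _)) h with +≤+ (ℕ.s≤s ()) ← y≤ h
unit-octagon (+ 0) -[1+ suc _ ] h with +≤+ (ℕ.s≤s ()) ← -y≤ h
unit-octagon (+ 1) (+ suc _) h with +≤+ (ℕ.s≤s ()) ← x+y≤ h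
unit-octagon (+ 1) -[1+ _ ] h with +≤+ (ℕ.s≤s ()) ← x-y≤ h
unit-octagon -[1+ 0 ] (+ suc _) h with +≤+ (ℕ.s≤s ()) ← -x+y≤ h
unit-octagon -[1+ 0 ] -[1+ _ ] h with +≤+ (ℕ.s≤s ()) ← -x-y≤ h

T-zero⇒A₀ : ∀ {z} → T 0 z → A₀ z
T-zero⇒A₀ {x + y i} t = unit-octagon x y (T⇒oct t)

-- Rounded division and small representatives

mul≤ : ∀ {k x y} → 0ℤ ≤ k → x ≤ y → k * x ≤ k * y
mul≤ {k} 0≤k = *-monoˡ-≤-nonNeg k {{nonNegative 0≤k}}

cancel≤ : ∀ {n x y} → 0ℤ < n → n * x ≤ n * y → x ≤ y
cancel≤ {n} {x} {y} 0<n = *-cancelˡ-≤-pos x y n {{positive 0<n}}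

Rounded : ℤ → ℤ → ℤ → Set
Rounded n s c = (s - c * n) + (s - c * n) ≤ n × - ((s - c * n) + (s - c * n)) ≤ n

round : ∀ n s → 0ℤ < n → ∃[ c ] Rounded n s c
round (+ suc n) s _ = go (+ suc n) s (+ (s DivMod.%ℕ suc n)) (s DivMod./ℕ suc n)
  (DivMod.a≡a%ℕn+[a/ℕn]*n s (suc n)) (+≤+ ℕ.z≤n) (<⇒≤ (+<+ (DivMod.n%ℕd<d s (suc n))))
  where
  go : ∀ n s r c → s ≡ r + c * n → 0ℤ ≤ r → r ≤ n → ∃[ c ] Rounded n s c
  -- Twice the remainder decides between rounding down to c and up to c + 1.
  go n s r c refl 0≤r r≤n = [ (λ 2r≤n → c , down₁ 2r≤n , down₂) , (λ n≤2r → c + + 1 , up₁ , up₂ n≤2r) ]′ (≤-total (r + r) n)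
    where
    down₁ : r + r ≤ n → (r + c * n - c * n) + (r + c * n - c * n) ≤ n
    down₁ 2r≤n = lin 0 2r≤n (solve (r ∷ c ∷ n ∷ []))
    down₂ : - ((r + c * n - c * n) + (r + c * n - c * n)) ≤ n
    down₂ = lin 0 (0≤r ⊕ 0≤r ⊕ 0≤r ⊕ r≤n) (solve (r ∷ c ∷ n ∷ []))
    up₁ : (r + c * n - (c + + 1) * n) + (r + c * n - (c + + 1) * n) ≤ n
    up₁ = lin 0 (0≤r ⊕ r≤n ⊕ r≤n ⊕ r≤n) (solve (r ∷ c ∷ n ∷ []))
    up₂ : n ≤ r + r → - ((r + c * n - (c + + 1) * n) + (r + c * n - (c + + 1) * n)) ≤ n
    up₂ n≤2r = lin 0 n≤2r (solve (r ∷ c ∷ n ∷ []))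
round (+ 0) s (+<+ ())

infix 4 _∼_[_]
_∼_[_] : ℤ[i] → ℤ[i] → ℤ[i] → Set
x ∼ r [ β ] = β ∣ᵍ (x -ᵍ r)

∼-unrot : ∀ β {x r} → x ∼ r [ rot β ] → x ∼ r [ β ]
∼-unrot (a + b i) ((c + d i) , e) = rot (c + d i) , trans (real a b c d ≡ᵍ imag a b c d) e
  where
  real : ∀ a b c d → a * - d - b * c ≡ - b * c - a * d
  real = solve-∀
  imag : ∀ a b c d → a * c + b * - d ≡ - b * d + a * c
  imag = solve-∀

∼-unconj : ∀ β {x r} → conj x ∼ r [ conj β ] → x ∼ conj r [ β ]
∼-unconj (a + b i) {x + y i} {u + v i} ((c + d i) , e) =
  conj (c + d i) , trans (real a b c d ≡ᵍ imag a b c d) (trans (cong conj e) (refl ≡ᵍ minus y v))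
  where
  real : ∀ a b c d → a * c - b * - d ≡ a * c - - b * d
  real = solve-∀
  imag : ∀ a b c d → a * - d + b * c ≡ - (a * d + - b * c)
  imag = solve-∀
  minus : ∀ y v → - (- y - v) ≡ y - - v
  minus = solve-∀

rot≢0 : ∀ {z} → z ≢ 0ᵍ → rot z ≢ 0ᵍ
rot≢0 {z} z≢0 e = z≢0 (trans (sym (rot⁴ z)) (cong (rot ∘ rot ∘ rot) e))

conj≢0 : ∀ {z} → z ≢ 0ᵍ → conj z ≢ 0ᵍ
conj≢0 {z} z≢0 e = z≢0 (trans (sym (conj² z)) (cong conj e))

norm : ℤ[i] → ℤ
norm (x + y i) = x * x + y * y

0≤j*j : ∀ j → 0ℤ ≤ j * j
0≤j*j (+ n)    = subst (0ℤ ≤_) (pos-* n n) (+≤+ ℕ.z≤n)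
0≤j*j -[1+ n ] = +≤+ ℕ.z≤n

norm-positive : ∀ z → z ≢ 0ᵍ → 0ℤ < norm z
norm-positive ((+ 0) + (+ 0) i)       z≢0 = ⊥-elim (z≢0 refl)
norm-positive ((+ suc _) + y i)       _   = +-mono-<-≤ {0ℤ} (+<+ (ℕ.s≤s ℕ.z≤n)) (0≤j*j y)
norm-positive (-[1+ _ ] + y i)        _   = +-mono-<-≤ {0ℤ} (+<+ (ℕ.s≤s ℕ.z≤n)) (0≤j*j y)
norm-positive ((+ 0) + (+ suc _) i)   _   = +<+ (ℕ.s≤s ℕ.z≤n)
norm-positive ((+ 0) + -[1+ _ ] i)    _   = +<+ (ℕ.s≤s ℕ.z≤n)

CloseRepresentative : ℤ[i] → Set
CloseRepresentative β = ∀ {m s k} → InOctagon m s β → s ≤ k + k + + 1 → β ≢ 0ᵍ →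
                        ∀ x → ∃[ r ] InOctagon k m r × x ∼ r [ β ]

-- The point u + v i is β (σ + τ i) / n with |σ|, |τ| ≤ n / 2, hence in the fundamental square of β
-- = a + b i centred at 0. There the coordinates are at most (a + b) / 2 and the diagonal forms at
-- most a; integrality rounds the former down to k.
quotient-octagon : ∀ {a b m k n u v σ τ} → 0ℤ ≤ b → b ≤ a → a ≤ m → a + b ≤ k + k + + 1 → 0ℤ < n →
  n * u ≡ a * σ - b * τ → n * v ≡ a * τ + b * σ →
  σ + σ ≤ n → - (σ + σ) ≤ n → τ + τ ≤ n → - (τ + τ) ≤ n → Octagon k m u v
quotient-octagon {a} {b} {m} {k} {n} {u} {v} {σ} {τ} 0≤b b≤a a≤m a+b≤ 0<n eᵤ eᵥ σ⁺ σ⁻ τ⁺ τ⁻ = record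
    { x≤    = side (cancel≤ 0<n (lin 0 (mul≤ 0≤a σ⁺ ⊕ mul≤ 0≤b τ⁻ ⊕ ≤-reflexive eᵤ ⊕ ≤-reflexive eᵤ)
        (solve (a ∷ b ∷ n ∷ u ∷ v ∷ σ ∷ τ ∷ []))))
    ; -x≤   = side (cancel≤ 0<n (lin 0 (mul≤ 0≤a σ⁻ ⊕ mul≤ 0≤b τ⁺ ⊕ ≤-reflexive (sym eᵤ) ⊕ ≤-reflexive (sym eᵤ))
        (solve (a ∷ b ∷ n ∷ u ∷ v ∷ σ ∷ τ ∷ []))))
    ; y≤    = side (cancel≤ 0<n (lin 0 (mul≤ 0≤a τ⁺ ⊕ mul≤ 0≤b σ⁺ ⊕ ≤-reflexive eᵥ ⊕ ≤-reflexive eᵥ)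
        (solve (a ∷ b ∷ n ∷ u ∷ v ∷ σ ∷ τ ∷ []))))
    ; -y≤   = side (cancel≤ 0<n (lin 0 (mul≤ 0≤a τ⁻ ⊕ mul≤ 0≤b σ⁻ ⊕ ≤-reflexive (sym eᵥ) ⊕ ≤-reflexive (sym eᵥ))
        (solve (a ∷ b ∷ n ∷ u ∷ v ∷ σ ∷ τ ∷ []))))
    ; x+y≤  = diagonal (cancel≤ 0<n (lin 0 (mul≤ 0≤a+b σ⁺ ⊕ mul≤ 0≤a-b τ⁺ ⊕ ≤-reflexive eᵤ ⊕ ≤-reflexive eᵤ ⊕ ≤-reflexive eᵥ ⊕ ≤-reflexive eᵥ)
        (solve (a ∷ b ∷ n ∷ u ∷ v ∷ σ ∷ τ ∷ []))))
    ; x-y≤  = diagonal (cancel≤ 0<n (lin 0 (mul≤ 0≤a-b σ⁺ ⊕ mul≤ 0≤a+b τ⁻ ⊕ ≤-reflexive eᵤ ⊕ ≤-reflexive eᵤ ⊕ ≤-reflexive (sym eᵥ) ⊕ ≤-reflexive (sym eᵥ))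
        (solve (a ∷ b ∷ n ∷ u ∷ v ∷ σ ∷ τ ∷ []))))
    ; -x+y≤ = diagonal (cancel≤ 0<n (lin 0 (mul≤ 0≤a-b σ⁻ ⊕ mul≤ 0≤a+b τ⁺ ⊕ ≤-reflexive (sym eᵤ) ⊕ ≤-reflexive (sym eᵤ) ⊕ ≤-reflexive eᵥ ⊕ ≤-reflexive eᵥ)
        (solve (a ∷ b ∷ n ∷ u ∷ v ∷ σ ∷ τ ∷ []))))
    ; -x-y≤ = diagonal (cancel≤ 0<n (lin 0 (mul≤ 0≤a+b σ⁻ ⊕ mul≤ 0≤a-b τ⁻ ⊕ ≤-reflexive (sym eᵤ) ⊕ ≤-reflexive (sym eᵤ) ⊕ ≤-reflexive (sym eᵥ) ⊕ ≤-reflexive (sym eᵥ))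
        (solve (a ∷ b ∷ n ∷ u ∷ v ∷ σ ∷ τ ∷ [])))) }
  where
  0≤a : 0ℤ ≤ a
  0≤a = ≤-trans 0≤b b≤a
  0≤a+b : 0ℤ ≤ a + b
  0≤a+b = +-mono-≤ 0≤a 0≤b
  0≤a-b : 0ℤ ≤ a - b
  0≤a-b = i≤j⇒0≤j-i b≤a
  side : ∀ {w} → w + w ≤ a + b → w ≤ k
  side {w} le = lin₂ 0 (le ⊕ a+b≤) (solve (w ∷ a ∷ b ∷ k ∷ []))
  diagonal : ∀ {w} → w + w ≤ a + a → w ≤ m
  diagonal {w} le = lin₂ 1 (le ⊕ a≤m ⊕ a≤m) (solve (w ∷ a ∷ m ∷ []))

close-octant : ∀ a b → 0ℤ ≤ b → b ≤ a → CloseRepresentative (a + b i)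
-- The rounded fractions are the coordinates of x + y i times the conjugate of β, divided by the
-- norm of β.
close-octant a b 0≤b b≤a {m} {s} {k} o s≤2k+1 β≢0 (x + y i) = go (round (a * a + b * b) (x * a + y * b) 0<n) (round (a * a + b * b) (y * a - x * b) 0<n)
  where
  0<n : 0ℤ < a * a + b * b
  0<n = norm-positive (a + b i) β≢0
  minus : ∀ x z → z ≡ x - (x - z)
  minus = solve-∀
  e₁ : ∀ a b c d x y → (a * a + b * b) * (x - (a * c - b * d)) ≡
       a * (x * a + y * b - c * (a * a + b * b)) - b * (y * a - x * b - d * (a * a + b * b))
  e₁ = solve-∀
  e₂ : ∀ a b c d x y → (a * a + b * b) * (y - (a * d + b * c)) ≡
       a * (y * a - x * b - d * (a * a + b * b)) + b * (x * a + y * b - c * (a * a + b * b))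
  e₂ = solve-∀
  go : ∃ (Rounded (a * a + b * b) (x * a + y * b)) → ∃ (Rounded (a * a + b * b) (y * a - x * b)) →
       ∃[ r ] InOctagon k m r × (x + y i) ∼ r [ a + b i ]
  go (c , σ⁺ , σ⁻) (d , τ⁺ , τ⁻) =
    ((x - (a * c - b * d)) + (y - (a * d + b * c)) i) ,
    quotient-octagon 0≤b b≤a (x≤ o) (≤-trans (x+y≤ o) s≤2k+1) 0<n (e₁ a b c d x y) (e₂ a b c d x y) σ⁺ σ⁻ τ⁺ τ⁻ ,
    (c + d i) , (minus x (a * c - b * d) ≡ᵍ minus y (a * d + b * c))

close-representative : ∀ β → CloseRepresentative β
close-representative = octant CloseRepresentative unrot unconj close-octant
  where
  unrot : ∀ β → CloseRepresentative (rot β) → CloseRepresentative β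
  unrot β close o s≤ β≢0 x with r , r-oct , x∼r ← close (rot-octagon β o) s≤ (rot≢0 β≢0) x =
    r , r-oct , ∼-unrot β {x} {r} x∼r
  unconj : ∀ β → CloseRepresentative (conj β) → CloseRepresentative β
  unconj β close o s≤ β≢0 x with r , r-oct , x∼r ← close (conj-octagon β o) s≤ (conj≢0 β≢0) (conj x) =
    conj r , conj-octagon r r-oct , ∼-unconj β {x} {r} x∼r

-- Half the diagonal bound 2 (q + 2 p - 2) + 1 of β rounds down to the axis bound one level below,
-- and the axis bound 2 q + 2 p - 2 of β becomes the diagonal bound of `Near`.
near-representative : ∀ {q p} β → Oct (p + p) q β → β ≢ 0ᵍ → ∀ x → ∃[ r ] Near q p r × x ∼ r [ β ]
near-representative {q} {p} β o β≢0 x = go (close-representative β {k = q + p + p - + 2} o sum≤ β≢0 x)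
  where
  sum≤ : p + p + (p + p) + q + q - + 3 ≤ (q + p + p - + 2) + (q + p + p - + 2) + + 1
  sum≤ = ≤-reflexive (solve (p ∷ q ∷ []))
  reorder : p + p + q + q - + 2 ≤ q + q + p + p - + 2
  reorder = ≤-reflexive (solve (p ∷ q ∷ []))
  go : ∃[ r ] InOctagon (q + p + p - + 2) (p + p + q + q - + 2) r × x ∼ r [ β ] → ∃[ r ] Near q p r × x ∼ r [ β ]
  go (r , r-oct , x∼r) = r , grow-octagon r ≤-refl reorder r-oct , x∼r

-- Subtracting unit multiples of an odd β

record Sized (q p a b : ℤ) : Set where
  field
    0≤b   : 0ℤ ≤ b
    b<a   : b + + 1 ≤ a
    a≤    : a ≤ p + p + q + q - + 2
    a+b≤  : a + b ≤ p + p + (p + p) + q + q - + 3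
open Sized

module _ {q p a b : ℤ} (adm : Admissible q p) (β : Sized q p a b) where

  private
    b≤ : b ≤ q + p + p - + 2
    b≤ = lin₂ 1 (b<a β ⊕ a+b≤ β) (solve (a ∷ b ∷ p ∷ q ∷ []))

  -- The bounds on a and a + b exceed those of `Near` by q and 2 p - 1; the hypotheses q ≤ x and 2 p
  -- ≤ x + y compensate for this.
  shift-upper : ∀ x y → 0ℤ ≤ y → y ≤ x → q ≤ x → p + p ≤ x + y → x ≤ q + p + p - + 2 → x + y ≤ q + q + p + p - + 2 →
                Octagon (q + p + p - + 2) (q + q + p + p - + 2) (x - a) (y - b)
  shift-upper x y 0≤y y≤x q≤x 2p≤x+y x≤W x+y≤V = record
    { x≤    = lin 1 (x≤W ⊕ b<a β ⊕ 0≤b β) (solve (a ∷ b ∷ p ∷ q ∷ x ∷ []))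
    ; -x≤   = lin 0 (a≤ β ⊕ q≤x) (solve (a ∷ p ∷ q ∷ x ∷ []))
    ; y≤    = lin 0 (y≤x ⊕ x≤W ⊕ 0≤b β) (solve (b ∷ p ∷ q ∷ x ∷ y ∷ []))
    ; -y≤   = lin 0 (b≤ ⊕ 0≤y) (solve (b ∷ p ∷ q ∷ y ∷ []))
    ; x+y≤  = lin 1 (x+y≤V ⊕ b<a β ⊕ 0≤b β ⊕ 0≤b β) (solve (a ∷ b ∷ p ∷ q ∷ x ∷ y ∷ []))
    ; x-y≤  = lin 1 (x+y≤V ⊕ b<a β ⊕ 0≤y ⊕ 0≤y) (solve (a ∷ b ∷ p ∷ q ∷ x ∷ y ∷ []))
    ; -x+y≤ = lin 0 (a≤ β ⊕ 0≤b β ⊕ y≤x) (solve (a ∷ b ∷ p ∷ q ∷ x ∷ y ∷ []))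
    ; -x-y≤ = lin 1 (a+b≤ β ⊕ 2p≤x+y) (solve (a ∷ b ∷ p ∷ q ∷ x ∷ y ∷ [])) }

  shift-lower : ∀ s t → 0ℤ ≤ s → s ≤ t → t ≤ q + p + p - + 2 → s + t ≤ q + q + p + p - + 2 → p + p ≤ s + t →
                a - s ≤ q + p + p - + 2 → t - s ≤ b →
                Octagon (q + p + p - + 2) (q + q + p + p - + 2) (s - a) (t - b)
  shift-lower s t 0≤s s≤t t≤W s+t≤V 2p≤s+t a-s≤W t-s≤b = record
    { x≤    = lin 1 (t≤W ⊕ s≤t ⊕ b<a β ⊕ 0≤b β) (solve (a ∷ b ∷ p ∷ q ∷ s ∷ t ∷ []))
    ; -x≤   = lin 0 a-s≤W (solve (a ∷ p ∷ q ∷ s ∷ []))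
    ; y≤    = lin 0 (t≤W ⊕ 0≤b β) (solve (b ∷ p ∷ q ∷ t ∷ []))
    ; -y≤   = lin 0 (b≤ ⊕ 0≤s ⊕ s≤t) (solve (b ∷ p ∷ q ∷ s ∷ t ∷ []))
    ; x+y≤  = lin 1 (s+t≤V ⊕ b<a β ⊕ 0≤b β ⊕ 0≤b β) (solve (a ∷ b ∷ p ∷ q ∷ s ∷ t ∷ []))
    ; x-y≤  = lin 1 (s+t≤V ⊕ b<a β ⊕ 0≤s ⊕ 0≤s ⊕ s≤t ⊕ s≤t) (solve (a ∷ b ∷ p ∷ q ∷ s ∷ t ∷ []))
    ; -x+y≤ = lin 0 (a≤ β ⊕ t-s≤b) (solve (a ∷ b ∷ p ∷ q ∷ s ∷ t ∷ []))
    ; -x-y≤ = lin 1 (a+b≤ β ⊕ 2p≤s+t) (solve (a ∷ b ∷ p ∷ q ∷ s ∷ t ∷ [])) }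

  -- The subtracted multiple is i β = - b + a i.
  shift-rotated : ∀ s t → 0ℤ ≤ s → s ≤ t → t ≤ q + p + p - + 2 → s + t ≤ q + q + p + p - + 2 → q ≤ t →
                  s + b ≤ q + p + p - + 2 → s + b - t + a ≤ q + q + p + p - + 2 →
                  Octagon (q + p + p - + 2) (q + q + p + p - + 2) (s - - b) (t - a)
  shift-rotated s t 0≤s s≤t t≤W s+t≤V q≤t s+b≤W diagonal = record
    { x≤    = lin 0 s+b≤W (solve (b ∷ p ∷ q ∷ s ∷ []))
    ; -x≤   = lin 0 (t≤W ⊕ s≤t ⊕ 0≤s ⊕ 0≤s ⊕ 0≤b β) (solve (b ∷ p ∷ q ∷ s ∷ t ∷ []))
    ; y≤    = lin 1 (t≤W ⊕ b<a β ⊕ 0≤b β) (solve (a ∷ b ∷ p ∷ q ∷ t ∷ []))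
    ; -y≤   = lin 0 (a≤ β ⊕ q≤t) (solve (a ∷ p ∷ q ∷ t ∷ []))
    ; x+y≤  = lin 1 (s+t≤V ⊕ b<a β) (solve (a ∷ b ∷ p ∷ q ∷ s ∷ t ∷ []))
    ; x-y≤  = lin 0 diagonal (solve (a ∷ b ∷ p ∷ q ∷ s ∷ t ∷ []))
    ; -x+y≤ = lin 1 (s+t≤V ⊕ b<a β ⊕ 0≤b β ⊕ 0≤b β ⊕ 0≤s ⊕ 0≤s) (solve (a ∷ b ∷ p ∷ q ∷ s ∷ t ∷ []))
    ; -x-y≤ = lin 0 (a≤ β ⊕ 0≤b β ⊕ 0≤s ⊕ 0≤s ⊕ s≤t) (solve (a ∷ b ∷ p ∷ q ∷ s ∷ t ∷ [])) }

  -- Outside the region of `inner`, q ≤ y or 2 p ≤ x - y. Since p ≤ q ≤ 2 p, either one gives both q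
  -- ≤ x and 2 p ≤ x + y.
  upper : ∀ x y → 0ℤ ≤ y → y ≤ x → x ≤ q + p + p - + 2 → x + y ≤ q + q + p + p - + 2 →
          q ≤ y ⊎ p + p ≤ x - y → Near q p ((x - a) + (y - b) i)
  upper x y 0≤y y≤x x≤W x+y≤V (inj₁ q≤y) = shift-upper x y 0≤y y≤x (≤-trans q≤y y≤x)
    (lin 0 (p≤q adm ⊕ p≤q adm ⊕ q≤y ⊕ q≤y ⊕ y≤x) (solve (p ∷ q ∷ x ∷ y ∷ []))) x≤W x+y≤V
  upper x y 0≤y y≤x x≤W x+y≤V (inj₂ 2p≤x-y) = shift-upper x y 0≤y y≤x
    (lin 0 (q≤2p adm ⊕ 2p≤x-y ⊕ 0≤y) (solve (p ∷ q ∷ x ∷ y ∷ [])))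
    (lin 0 (2p≤x-y ⊕ 0≤y ⊕ 0≤y) (solve (p ∷ q ∷ x ∷ y ∷ []))) x≤W x+y≤V

  -- The point now lies on the other side of the diagonal from β. Subtracting i β endangers the
  -- right and lower right sides, subtracting β the left and upper left ones; in each case a
  -- comparison selects the multiple that works.
  lower : ∀ s t → 0ℤ ≤ s → s ≤ t → t ≤ q + p + p - + 2 → s + t ≤ q + q + p + p - + 2 →
          q ≤ s ⊎ p + p ≤ t - s → Near q p ((s - a) + (t - b) i) ⊎ Near q p ((s - - b) + (t - a) i)
  lower s t 0≤s s≤t t≤W s+t≤V (inj₁ q≤s) = [ inj₂ ∘ rotated , inj₁ ∘ direct ]′ (≤-total b (t - s))
    where
    rotated : b ≤ t - s → Near q p ((s - - b) + (t - a) i)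
    rotated b≤t-s = shift-rotated s t 0≤s s≤t t≤W s+t≤V (≤-trans q≤s s≤t)
      (lin 0 (b≤t-s ⊕ t≤W) (solve (b ∷ p ∷ q ∷ s ∷ t ∷ [])))
      (lin 0 (b≤t-s ⊕ a≤ β) (solve (a ∷ b ∷ p ∷ q ∷ s ∷ t ∷ [])))
    direct : t - s ≤ b → Near q p ((s - a) + (t - b) i)
    direct t-s≤b = shift-lower s t 0≤s s≤t t≤W s+t≤V
      (lin 0 (p≤q adm ⊕ p≤q adm ⊕ q≤s ⊕ q≤s ⊕ s≤t) (solve (p ∷ q ∷ s ∷ t ∷ [])))
      (lin 0 (a≤ β ⊕ q≤s) (solve (a ∷ p ∷ q ∷ s ∷ []))) t-s≤b
  -- If i β fails on the right, s + b is so large that a - s = (a + b) - (s + b) respects the left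
  -- side.
  lower s t 0≤s s≤t t≤W s+t≤V (inj₂ 2p≤t-s) = [ inj₂ ∘ rotated , inj₁ ∘ direct ]′ (compare (s + b) (q + p + p - + 2))
    where
    rotated : s + b ≤ q + p + p - + 2 → Near q p ((s - - b) + (t - a) i)
    rotated s+b≤W = shift-rotated s t 0≤s s≤t t≤W s+t≤V
      (lin 0 (q≤2p adm ⊕ 2p≤t-s ⊕ 0≤s) (solve (p ∷ q ∷ s ∷ t ∷ []))) s+b≤W
      (lin 1 (a+b≤ β ⊕ 2p≤t-s) (solve (a ∷ b ∷ p ∷ q ∷ s ∷ t ∷ [])))
    direct : q + p + p - + 2 + + 1 ≤ s + b → Near q p ((s - a) + (t - b) i)
    direct W<s+b = shift-lower s t 0≤s s≤t t≤W s+t≤V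
      (lin 0 (2p≤t-s ⊕ 0≤s ⊕ 0≤s) (solve (p ∷ s ∷ t ∷ [])))
      (lin 0 (a+b≤ β ⊕ W<s+b) (solve (a ∷ b ∷ p ∷ q ∷ s ∷ [])))
      (lin 1 (t≤W ⊕ W<s+b) (solve (b ∷ p ∷ q ∷ s ∷ t ∷ [])))

-- Parity and divisibility by 1 + i

rot³ : ℤ[i] → ℤ[i]
rot³ = rot ∘ rot ∘ rot

rot-∣ : ∀ β {δ} → β ∣ᵍ δ → β ∣ᵍ rot δ
rot-∣ (a + b i) ((c + d i) , e) = rot (c + d i) , trans (real a b c d ≡ᵍ imag a b c d) (cong rot e)
  where
  real : ∀ a b c d → a * - d - b * c ≡ - (a * d + b * c)
  real = solve-∀
  imag : ∀ a b c d → a * c + b * - d ≡ a * c - b * d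
  imag = solve-∀

rot-minus : ∀ z w → rot (z -ᵍ w) ≡ rot z -ᵍ rot w
rot-minus (x + y i) (u + v i) = imag y v ≡ᵍ refl
  where
  imag : ∀ y v → - (y - v) ≡ - y - - v
  imag = solve-∀

odd-minus : ∀ z w → Odd z → Even w → Odd (z -ᵍ w)
odd-minus (x + y i) (u + v i) (h , e) (g , f) = h - g , trans (split x y u v) (trans (cong₂ _-_ e f) (solve (h ∷ g ∷ [])))
  where
  split : ∀ x y u v → x - u + (y - v) ≡ (x + y) - (u + v)
  split = solve-∀

even-minus : ∀ z w → Even z → Odd w → Odd (z -ᵍ w)
even-minus (x + y i) (u + v i) (h , e) (g , f) = h - g - + 1 , trans (split x y u v) (trans (cong₂ _-_ e f) (solve (h ∷ g ∷ [])))
  where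
  split : ∀ x y u v → x - u + (y - v) ≡ (x + y) - (u + v)
  split = solve-∀

twist-even : ∀ z → Even (twist z)
twist-even (x + y i) = x , cancel x y
  where
  cancel : ∀ x y → x - y + (x + y) ≡ x + x
  cancel = solve-∀

-- The quotient by 1 + i has coordinates (x + y) / 2 and (y - x) / 2, which are integral when x + y
-- is even.
untwist : ∀ z → Even z → ∃[ w ] twist w ≡ z
untwist (x + y i) (h , e) = (h + (y - h) i) , (trans (real h y) (trans (cong (_- y) (sym e)) (cancel x y)) ≡ᵍ imag h y)
  where
  real : ∀ h y → h - (y - h) ≡ h + h - y
  real = solve-∀
  cancel : ∀ x y → x + y - y ≡ x
  cancel = solve-∀
  imag : ∀ h y → h + (y - h) ≡ y
  imag = solve-∀

twist-* : ∀ z w → twist z *ᵍ w ≡ twist (z *ᵍ w)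
twist-* (a + b i) (c + d i) = real a b c d ≡ᵍ imag a b c d
  where
  real : ∀ a b c d → (a - b) * c - (a + b) * d ≡ a * c - b * d - (a * d + b * c)
  real = solve-∀
  imag : ∀ a b c d → (a - b) * d + (a + b) * c ≡ a * c - b * d + (a * d + b * c)
  imag = solve-∀

twist-minus : ∀ z w → twist (z -ᵍ w) ≡ twist z -ᵍ twist w
twist-minus (x + y i) (u + v i) = real x y u v ≡ᵍ imag x y u v
  where
  real : ∀ x y u v → x - u - (y - v) ≡ x - y - (u - v)
  real = solve-∀
  imag : ∀ x y u v → x - u + (y - v) ≡ x + y - (u + v)
  imag = solve-∀

minus-minus : ∀ z w → z -ᵍ (z -ᵍ w) ≡ w
minus-minus (x + y i) (u + v i) = cancel x u ≡ᵍ cancel y v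
  where
  cancel : ∀ x u → x - (x - u) ≡ u
  cancel = solve-∀

twist-∼ : ∀ β {x r} → x ∼ r [ β ] → twist x ∼ twist r [ twist β ]
twist-∼ β {x} {r} (c , e) = c , trans (twist-* β c) (trans (cong twist e) (twist-minus x r))

∼-minus : ∀ β {x r δ} → x ∼ r [ β ] → β ∣ᵍ δ → x ∼ (r -ᵍ δ) [ β ]
∼-minus (a + b i) {x + y i} {u + v i} {δ₁ + δ₂ i} ((c + d i) , e) ((c′ + d′ i) , e′) =
  ((c + c′) + (d + d′) i) , (trans (real a b c d c′ d′) (trans (cong₂ (λ z w → re z + re w) e e′) (rearrange x u δ₁))
    ≡ᵍ trans (imag a b c d c′ d′) (trans (cong₂ (λ z w → im z + im w) e e′) (rearrange y v δ₂)))
  where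
  real : ∀ a b c d c′ d′ → a * (c + c′) - b * (d + d′) ≡ (a * c - b * d) + (a * c′ - b * d′)
  real = solve-∀
  imag : ∀ a b c d c′ d′ → a * (d + d′) + b * (c + c′) ≡ (a * d + b * c) + (a * d′ + b * c′)
  imag = solve-∀
  rearrange : ∀ x u δ → (x - u) + δ ≡ x - (u - δ)
  rearrange = solve-∀

-- Multiples of 1 + i are even, so congruence modulo `twist β` preserves parity.
even-rep-odd : ∀ β x r → x ∼ r [ twist β ] → Odd x → Odd r
even-rep-odd β x r (c , e) x-odd = subst Odd (minus-minus x r)
  (odd-minus x (x -ᵍ r) x-odd (subst Even (trans (sym (twist-* β c)) e) (twist-even (β *ᵍ c))))

odd≢0 : ∀ z → Odd z → z ≢ 0ᵍ
odd≢0 z (g , e) refl = even≢odd 0ℤ g e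

-- Applied to even z, for which z - δ is odd.
Shiftable : ℕ → ℤ[i] → ℤ[i] → Set
Shiftable n β z = Near (q n) (p n) z → T n z ⊎ (∃[ δ ] Odd δ × β ∣ᵍ δ × Near (q n) (p n) (z -ᵍ δ))

shiftable-unrot : ∀ n β z → Shiftable n β (rot z) → Shiftable n β z
shiftable-unrot n β z shift near = [ inj₁ ∘ T-unrot z , inj₂ ∘ rotated ]′ (shift (rot-octagon z near))
  where
  rotated : (∃[ δ ] Odd δ × β ∣ᵍ δ × Near (q n) (p n) (rot z -ᵍ δ)) →
            ∃[ δ ] Odd δ × β ∣ᵍ δ × Near (q n) (p n) (z -ᵍ δ)
  -- `rot³` inverts `rot`, so `rot z -ᵍ δ` is the quarter turn of `z -ᵍ rot³ δ`.
  rotated (δ , δ-odd , β∣δ , near′) = rot³ δ , rot-odd (rot (rot δ)) (rot-odd (rot δ) (rot-odd δ δ-odd)) , rot-∣ β {rot (rot δ)} (rot-∣ β {rot δ} (rot-∣ β {δ} β∣δ)) ,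
    unrot-octagon (z -ᵍ rot³ δ) (subst (Near (q n) (p n)) (sym (trans (rot-minus z (rot³ δ)) (cong (rot z -ᵍ_) (rot⁴ δ)))) near′)

∣-refl : ∀ β → β ∣ᵍ β
∣-refl (a + b i) = ((+ 1) + (+ 0) i) , (real a b ≡ᵍ imag a b)
  where
  real : ∀ a b → a * + 1 - b * + 0 ≡ a
  real = solve-∀
  imag : ∀ a b → a * + 0 + b * + 1 ≡ b
  imag = solve-∀

-- In the upper half of the cone |y| ≤ x, β itself is subtracted. Conjugation would change β, so in
-- the lower half only membership in Tₙ is reflected, while the shift is applied to the quarter turn
-- - y + x i.
shiftable : ∀ n a b → Sized (q n) (p n) a b → Odd (a + b i) → ∀ z → Shiftable n (a + b i) z
shiftable n a b β β-odd = sector (Shiftable n (a + b i)) (shiftable-unrot n (a + b i)) base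
  where
  Shifted : ℤ[i] → Set
  Shifted z = T n z ⊎ (∃[ δ ] Odd δ × (a + b i) ∣ᵍ δ × Near (q n) (p n) (z -ᵍ δ))
  outer : ∀ y x → (y + + 1 ≤ q n → x - y + + 1 ≤ p n + p n → T n (x + y i)) →
          T n (x + y i) ⊎ (q n ≤ y ⊎ p n + p n ≤ x - y)
  outer y x inside with compare (q n) y | compare (p n + p n) (x - y)
  ... | inj₁ q≤y | _        = inj₂ (inj₁ q≤y)
  ... | inj₂ _   | inj₁ 2p≤ = inj₂ (inj₂ 2p≤)
  ... | inj₂ y<q | inj₂ <2p = inj₁ (inside y<q <2p)
  base : ∀ x y → y ≤ x → - x ≤ y → Shiftable n (a + b i) (x + y i)
  base x y y≤x -x≤y near = [ above , below ]′ (≤-total 0ℤ y)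
    where
    above : 0ℤ ≤ y → Shifted (x + y i)
    above 0≤y = [ inj₁ , (λ out → inj₂ ((a + b i) , β-odd , ∣-refl (a + b i) ,
                  upper (admissible n) β x y 0≤y y≤x (x≤ near) (x+y≤ near) out)) ]′ (outer y x (inner n x y 0≤y y≤x))
    below : y ≤ 0ℤ → Shifted (x + y i)
    below y≤0 = [ inj₁ ∘ T-unconj (x + y i) , outside ]′ (outer (- y) x (inner n x (- y) 0≤-y -y≤x))
      where
      0≤-y : 0ℤ ≤ - y
      0≤-y = neg-mono-≤ y≤0
      -y≤x : - y ≤ x
      -y≤x = lin 0 -x≤y (solve (x ∷ y ∷ []))
      -y+x : - y + x ≤ q n + q n + p n + p n - + 2
      -y+x = subst (_≤ q n + q n + p n + p n - + 2) (+-comm x (- y)) (x-y≤ near)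
      outside : q n ≤ - y ⊎ p n + p n ≤ x - - y → Shifted (x + y i)
      outside out = shiftable-unrot n (a + b i) (x + y i) (λ _ → inj₂
        ([ (λ near′ → (a + b i) , β-odd , ∣-refl (a + b i) , near′)
         , (λ near′ → rot (a + b i) , rot-odd (a + b i) β-odd , rot-∣ (a + b i) (∣-refl (a + b i)) , near′) ]′
         (lower (admissible n) β (- y) x 0≤-y -y≤x (x≤ near) -y+x out))) near

-- Tₙ covers the residues modulo nonzero elements of Tₙ₊₁

Cover : ℕ → ℤ[i] → Set
Cover n β = ∀ x → ∃[ r ] T n r × x ∼ r [ β ]

cover-odd : ∀ n β → Odd β → Oct (q (suc n)) (p (suc n)) β → Cover n β
cover-odd n = octant (λ β → Odd β → Oct (q (suc n)) (p (suc n)) β → Cover n β) unrot unconj base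
  where
  unrot : ∀ β → (Odd (rot β) → Oct (q (suc n)) (p (suc n)) (rot β) → Cover n (rot β)) →
          Odd β → Oct (q (suc n)) (p (suc n)) β → Cover n β
  unrot β cover β-odd o x with r , r∈T , x∼r ← cover (rot-odd β β-odd) (rot-octagon β o) x =
    r , r∈T , ∼-unrot β {x} {r} x∼r
  unconj : ∀ β → (Odd (conj β) → Oct (q (suc n)) (p (suc n)) (conj β) → Cover n (conj β)) →
           Odd β → Oct (q (suc n)) (p (suc n)) β → Cover n β
  unconj β cover β-odd o x with r , r∈T , x∼r ← cover (conj-odd β β-odd) (conj-octagon β o) (conj x) =
    conj r , T-conj r∈T , ∼-unconj β {x} {r} x∼r
  base : ∀ a b → 0ℤ ≤ b → b ≤ a → Odd (a + b i) → Oct (q (suc n)) (p (suc n)) (a + b i) → Cover n (a + b i)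
  base a b 0≤b b≤a β-odd@(h , e) o x = go (near-representative {q n} {p n} (a + b i) o (odd≢0 (a + b i) β-odd) x)
    where
    strict : b + + 1 ≤ a
    -- Equality a = b would make a + b even.
    strict = [ (λ a≤b → ⊥-elim (even≢odd b h (trans (cong (_+ b) (≤-antisym b≤a a≤b)) e))) , (λ lt → lt) ]′ (compare a b)
    sized : Sized (q n) (p n) a b
    sized = record { 0≤b = 0≤b ; b<a = strict ; a≤ = x≤ o ; a+b≤ = x+y≤ o }
    go : ∃[ r ] Near (q n) (p n) r × x ∼ r [ a + b i ] → ∃[ r ] T n r × x ∼ r [ a + b i ]
    go (r , near , x∼r) = [ r-even , r-odd ]′ (even⊎odd r)
      where
      r-odd : Odd r → ∃[ r ] T n r × x ∼ r [ a + b i ]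
      r-odd o = r , oddᵗ o (near-odd⇒oct {q n} {p n} r near o) , x∼r
      r-even : Even r → ∃[ r ] T n r × x ∼ r [ a + b i ]
      r-even ev = [ (λ r∈T → r , r∈T , x∼r) , shifted ]′ (shiftable n a b sized β-odd r near)
        where
        shifted : (∃[ δ ] Odd δ × (a + b i) ∣ᵍ δ × Near (q n) (p n) (r -ᵍ δ)) → ∃[ r ] T n r × x ∼ r [ a + b i ]
        shifted (δ , δ-odd , β∣δ , near′) = (r -ᵍ δ) ,
          oddᵗ r-δ-odd (near-odd⇒oct {q n} {p n} (r -ᵍ δ) near′ r-δ-odd) , ∼-minus (a + b i) {x} {r} {δ} x∼r β∣δ
          where
          r-δ-odd : Odd (r -ᵍ δ)
          r-δ-odd = even-minus r δ ev δ-odd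

unit∣ : ∀ {u} → A₀ u → u ≢ 0ᵍ → ∀ z → u ∣ᵍ z
unit∣ zero∈ u≢0 z = ⊥-elim (u≢0 refl)
unit∣ one∈ _ (x + y i) = (x + y i) , (real x y ≡ᵍ imag x y)
  where
  real : ∀ x y → + 1 * x - + 0 * y ≡ x
  real = solve-∀
  imag : ∀ x y → + 1 * y + + 0 * x ≡ y
  imag = solve-∀
unit∣ mone∈ _ (x + y i) = ((- x) + (- y) i) , (real x y ≡ᵍ imag x y)
  where
  real : ∀ x y → - (+ 1) * - x - + 0 * - y ≡ x
  real = solve-∀
  imag : ∀ x y → - (+ 1) * - y + + 0 * - x ≡ y
  imag = solve-∀
unit∣ i∈ _ (x + y i) = (y + (- x) i) , (real x y ≡ᵍ imag x y)
  where
  real : ∀ x y → + 0 * y - + 1 * - x ≡ x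
  real = solve-∀
  imag : ∀ x y → + 0 * - x + + 1 * y ≡ y
  imag = solve-∀
unit∣ mi∈ _ (x + y i) = ((- y) + x i) , (real x y ≡ᵍ imag x y)
  where
  real : ∀ x y → + 0 * - y - - (+ 1) * x ≡ x
  real = solve-∀
  imag : ∀ x y → + 0 * x + - (+ 1) * - y ≡ y
  imag = solve-∀

-- Modulo (1 + i) γ, a small representative of an odd class is odd and so lies in Dₙ; an even class
-- is 1 + i times a class modulo γ, which is covered one level below.
cover : ∀ n {β} → T (suc n) β → β ≢ 0ᵍ → Cover n β
cover n zeroᵗ β≢0 = ⊥-elim (β≢0 refl)
cover n (oddᵗ {z = β} β-odd o) _ = cover-odd n β β-odd o
cover n (twistᵗ {z = γ} t) β≢0 x = [ x-even , x-odd ]′ (even⊎odd x)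
  where
  γ≢0 : γ ≢ 0ᵍ
  γ≢0 refl = β≢0 refl
  x-odd : Odd x → ∃[ r ] T n r × x ∼ r [ twist γ ]
  x-odd o = go (near-representative {q n} {p n} (twist γ) (twist-oct {q n} {p n} γ (T⇒oct t)) β≢0 x)
    where
    go : ∃[ r ] Near (q n) (p n) r × x ∼ r [ twist γ ] → ∃[ r ] T n r × x ∼ r [ twist γ ]
    go (r , near , x∼r) = r , oddᵗ r-odd (near-odd⇒oct {q n} {p n} r near r-odd) , x∼r
      where
      r-odd : Odd r
      r-odd = even-rep-odd γ x r x∼r o
  halves : ∀ n → T n γ → ∀ y → ∃[ r ] T n (twist r) × y ∼ r [ γ ]
  -- At level 0, γ is a unit, so 0 represents every class modulo γ.
  halves zero    t y = 0ᵍ , zeroᵗ , unit∣ (T-zero⇒A₀ t) γ≢0 (y -ᵍ 0ᵍ)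
  halves (suc n) t y with r , r∈T , y∼r ← cover n t γ≢0 y = r , twistᵗ r∈T , y∼r
  x-even : Even x → ∃[ r ] T n r × x ∼ r [ twist γ ]
  x-even ev = go (untwist x ev)
    where
    go : ∃[ y ] twist y ≡ x → ∃[ r ] T n r × x ∼ r [ twist γ ]
    go (y , refl) = double (halves n t y)
      where
      double : ∃[ r ] T n (twist r) × y ∼ r [ γ ] → ∃[ r ] T n r × twist y ∼ r [ twist γ ]
      double (r , r∈T , y∼r) = twist r , r∈T , twist-∼ γ {y} {r} y∼r

-- Necessity of the octagon for odd β

∼-rot : ∀ β {x r} → x ∼ r [ β ] → x ∼ r [ rot β ]
∼-rot β {x} {r} d = ∼-unrot (rot β) {x} {r} (∼-unrot (rot (rot β)) {x} {r} (∼-unrot (rot³ β) {x} {r}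
  (subst (λ α → x ∼ r [ α ]) (sym (rot⁴ β)) d)))

0≤j*k : ∀ {j k} → 0ℤ ≤ j → 0ℤ ≤ k → 0ℤ ≤ j * k
0≤j*k {j} 0≤j 0≤k = subst (_≤ j * _) (*-zeroʳ j) (mul≤ 0≤j 0≤k)

OctCover : ℤ → ℤ → ℤ[i] → Set
OctCover q p β = ∀ x → ∃[ r ] Oct q p r × x ∼ r [ β ]

-- For a ≥ b ≥ 0 and a + b = 2 h + 1, the class of the lattice point (h - b) + h i next to
-- the centre β (1 + i) / 2 of the fundamental square has only large representatives.
module _ {a b h m s : ℤ} (0≤b : 0ℤ ≤ b) (b≤a : b ≤ a) (a+b : a + b ≡ h + h + + 1) where

  private
    0≤a : 0ℤ ≤ a
    0≤a = ≤-trans 0≤b b≤a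
    0≤a-b : 0ℤ ≤ a - b
    0≤a-b = i≤j⇒0≤j-i b≤a

  centre-bounds : ∀ u v c d → Octagon m s u v → a * c - b * d ≡ h - b - u → a * d + b * c ≡ h - v →
                  h ≤ m × a ≤ s + + 1
  centre-bounds u v c d o e₁ e₂ = cases (compare c 0ℤ) (compare d 0ℤ)
    where
    E = ≤-reflexive a+b
    E′ = ≤-reflexive (sym a+b)
    E₁ = ≤-reflexive e₁
    E₁′ = ≤-reflexive (sym e₁)
    E₂ = ≤-reflexive e₂
    E₂′ = ≤-reflexive (sym e₂)
    0≤pred : ∀ {c} → + 1 ≤ c → 0ℤ ≤ c - + 1
    0≤pred = i≤j⇒0≤j-i
    0≤neg : ∀ {c} → c ≤ 0ℤ → 0ℤ ≤ - c
    0≤neg = neg-mono-≤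
    -- The representative is β ((1/2 - c) + (1/2 - d) i) - (1 + i) / 2, and both half-integers are
    -- at least 1/2 in absolute value. Their signs select an axis form that is at least h and a
    -- diagonal form that is at least a - 1.
    cases : c ≤ 0ℤ ⊎ + 1 ≤ c → d ≤ 0ℤ ⊎ + 1 ≤ d → h ≤ m × a ≤ s + + 1
    cases (inj₁ c≤0) (inj₁ d≤0) =
      lin 0 (E₂′ ⊕ 0≤j*k 0≤a (0≤neg d≤0) ⊕ 0≤j*k 0≤b (0≤neg c≤0) ⊕ y≤ o)
        (solve (a ∷ b ∷ c ∷ d ∷ h ∷ m ∷ v ∷ [])) ,
      lin 0 (E₂′ ⊕ 0≤j*k 0≤a-b (0≤neg d≤0) ⊕ 0≤j*k 0≤b (0≤neg c≤0) ⊕ E₁′ ⊕ 0≤j*k 0≤a (0≤neg c≤0) ⊕ x+y≤ o ⊕ E)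
        (solve (a ∷ b ∷ c ∷ d ∷ h ∷ s ∷ u ∷ v ∷ []))
    cases (inj₂ c≥1) (inj₂ d≥1) =
      lin 1 (-y≤ o ⊕ 0≤j*k 0≤b (0≤pred c≥1) ⊕ E′ ⊕ 0≤j*k 0≤a (0≤pred d≥1) ⊕ E₂)
        (solve (a ∷ b ∷ c ∷ d ∷ h ∷ m ∷ v ∷ [])) ,
      lin 2 (-x-y≤ o ⊕ 0≤j*k 0≤a (0≤pred c≥1) ⊕ E₁ ⊕ E′ ⊕ 0≤j*k 0≤b (0≤pred c≥1) ⊕ 0≤j*k 0≤a-b (0≤pred d≥1) ⊕ E₂)
        (solve (a ∷ b ∷ c ∷ d ∷ h ∷ s ∷ u ∷ v ∷ []))
    cases (inj₁ c≤0) (inj₂ d≥1) =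
      lin 0 (0≤j*k 0≤b (0≤pred d≥1) ⊕ E₁′ ⊕ 0≤j*k 0≤a (0≤neg c≤0) ⊕ x≤ o)
        (solve (a ∷ b ∷ c ∷ d ∷ h ∷ m ∷ u ∷ [])) ,
      lin 1 (0≤j*k 0≤b (0≤pred d≥1) ⊕ E₁′ ⊕ 0≤j*k 0≤a-b (0≤neg c≤0) ⊕ 0≤j*k 0≤a (0≤pred d≥1) ⊕ E₂ ⊕ x-y≤ o)
        (solve (a ∷ b ∷ c ∷ d ∷ h ∷ s ∷ u ∷ v ∷ []))
    cases (inj₂ c≥1) (inj₁ d≤0) =
      lin 1 (-x≤ o ⊕ E′ ⊕ 0≤j*k 0≤a (0≤pred c≥1) ⊕ E₁ ⊕ 0≤j*k 0≤b (0≤neg d≤0))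
        (solve (a ∷ b ∷ c ∷ d ∷ h ∷ m ∷ u ∷ [])) ,
      lin 1 (E₂′ ⊕ 0≤j*k 0≤a (0≤neg d≤0) ⊕ 0≤j*k 0≤a-b (0≤pred c≥1) ⊕ E₁ ⊕ 0≤j*k 0≤b (0≤neg d≤0) ⊕ -x+y≤ o)
        (solve (a ∷ b ∷ c ∷ d ∷ h ∷ s ∷ u ∷ v ∷ []))

oct-cover⇒oct : ∀ {q p} β → Odd β → OctCover q p β → Oct (p + p) q β
oct-cover⇒oct {q} {p} = octant (λ β → Odd β → OctCover q p β → Oct (p + p) q β) unrot unconj base
  where
  unrot : ∀ β → (Odd (rot β) → OctCover q p (rot β) → Oct (p + p) q (rot β)) → Odd β → OctCover q p β → Oct (p + p) q β
  unrot β bound β-odd cov = unrot-octagon β (bound (rot-odd β β-odd) cov′)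
    where
    cov′ : OctCover q p (rot β)
    cov′ x with r , r-oct , x∼r ← cov x = r , r-oct , ∼-rot β {x} {r} x∼r
  unconj : ∀ β → (Odd (conj β) → OctCover q p (conj β) → Oct (p + p) q (conj β)) → Odd β → OctCover q p β → Oct (p + p) q β
  unconj β bound β-odd cov = unconj-octagon β (bound (conj-odd β β-odd) cov′)
    where
    cov′ : OctCover q p (conj β)
    cov′ x with r , r-oct , x∼r ← cov (conj x) = conj r , conj-octagon r r-oct ,
      ∼-unconj (conj β) {x} {r} (subst (λ α → conj x ∼ r [ α ]) (sym (conj² β)) x∼r)
  base : ∀ a b → 0ℤ ≤ b → b ≤ a → Odd (a + b i) → OctCover q p (a + b i) → Oct (p + p) q (a + b i)
  base a b 0≤b b≤a (h , a+b) cov = go (cov ((h - b) + h i))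
    where
    -- Here a + b = 2 h + 1 ≤ 2 q + 4 p - 3 and a ≤ 2 q + 2 p - 2, exactly the bounds of
    -- `Oct (p + p) q`.
    finish : h ≤ q + p + p - + 2 → a ≤ q + q + p + p - + 3 + + 1 → Oct (p + p) q (a + b i)
    finish h≤ a≤ = octant-octagon a b 0≤b b≤a
      (lin 0 a≤ (solve (a ∷ p ∷ q ∷ [])))
      (lin 0 (≤-reflexive a+b ⊕ h≤ ⊕ h≤) (solve (a ∷ b ∷ h ∷ p ∷ q ∷ [])))
    go : ∃[ r ] Oct q p r × ((h - b) + h i) ∼ r [ a + b i ] → Oct (p + p) q (a + b i)
    go ((u + v i) , o , (c + d i) , e) with h≤ , a≤ ← centre-bounds 0≤b b≤a a+b u v c d o (cong re e) (cong im e) = finish h≤ a≤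

-- Norms, and divisors of elements of the Motzkin sets

norm-* : ∀ z w → norm (z *ᵍ w) ≡ norm z * norm w
norm-* (a + b i) (c + d i) = identity a b c d
  where
  identity : ∀ a b c d → (a * c - b * d) * (a * c - b * d) + (a * d + b * c) * (a * d + b * c) ≡
             (a * a + b * b) * (c * c + d * d)
  identity = solve-∀

*ᵍ-assoc : ∀ z w v → (z *ᵍ w) *ᵍ v ≡ z *ᵍ (w *ᵍ v)
*ᵍ-assoc (a + b i) (c + d i) (e + f i) = real a b c d e f ≡ᵍ imag a b c d e f
  where
  real : ∀ a b c d e f → (a * c - b * d) * e - (a * d + b * c) * f ≡ a * (c * e - d * f) - b * (c * f + d * e)
  real = solve-∀
  imag : ∀ a b c d e f → (a * c - b * d) * f + (a * d + b * c) * e ≡ a * (c * f + d * e) + b * (c * e - d * f)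
  imag = solve-∀

product≢0 : ∀ {z w} → z ≢ 0ᵍ → w ≢ 0ᵍ → z *ᵍ w ≢ 0ᵍ
product≢0 {z} {w} z≢0 w≢0 zw≡0 = <-irrefl refl (subst (0ℤ <_) nzw≡0 (norm-positive² (norm z) (norm w) (norm-positive z z≢0) (norm-positive w w≢0)))
  where
  norm-positive² : ∀ n m → 0ℤ < n → 0ℤ < m → 0ℤ < n * m
  norm-positive² (+ suc _) (+ suc _) _ _ = +<+ (ℕ.s≤s ℕ.z≤n)
  norm-positive² (+ 0) m (+<+ ()) _
  norm-positive² (+ suc _) (+ 0) _ (+<+ ())
  nzw≡0 : norm z * norm w ≡ 0ℤ
  nzw≡0 = trans (sym (norm-* z w)) (cong norm zw≡0)

A₀-norm : ∀ {z} → A₀ z → z ≢ 0ᵍ → norm z ≡ + 1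
A₀-norm zero∈ z≢0 = ⊥-elim (z≢0 refl)
A₀-norm one∈  _ = refl
A₀-norm mone∈ _ = refl
A₀-norm i∈    _ = refl
A₀-norm mi∈   _ = refl

j≤j*j : ∀ j → j ≤ j * j
j≤j*j (+ 0)     = ≤-refl
j≤j*j (+ suc n) = +≤+ (ℕP.m≤m*n (suc n) (suc n))
j≤j*j -[1+ n ]  = -≤+

-j≤j*j : ∀ j → - j ≤ j * j
-j≤j*j j = subst (- j ≤_) (square-neg j) (j≤j*j (- j))
  where
  square-neg : ∀ j → - j * - j ≡ j * j
  square-neg = solve-∀

norm≤1⇒A₀ : ∀ z → norm z ≤ + 1 → A₀ z
norm≤1⇒A₀ (x + y i) n≤1 = unit-octagon x y (go n≤1)
  where
  go : x * x + y * y ≤ + 1 → Octagon (+ 1) (+ 1) x y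
  go n≤1 = record
    { x≤ = lin 0 (j≤j*j x ⊕ 0≤j*j y ⊕ n≤1) (solve (x ∷ y ∷ []))
    ; -x≤ = lin 0 (-j≤j*j x ⊕ 0≤j*j y ⊕ n≤1) (solve (x ∷ y ∷ []))
    ; y≤ = lin 0 (j≤j*j y ⊕ 0≤j*j x ⊕ n≤1) (solve (x ∷ y ∷ []))
    ; -y≤ = lin 0 (-j≤j*j y ⊕ 0≤j*j x ⊕ n≤1) (solve (x ∷ y ∷ []))
    ; x+y≤ = ≤-trans (j≤j*j x ⊕ j≤j*j y) n≤1
    ; x-y≤ = ≤-trans (j≤j*j x ⊕ -j≤j*j y) n≤1
    ; -x+y≤ = ≤-trans (-j≤j*j x ⊕ j≤j*j y) n≤1
    ; -x-y≤ = ≤-trans (-j≤j*j x ⊕ -j≤j*j y) n≤1 }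

-- At level 0 the norm of α is a positive divisor of 1. At higher levels, a set that covers the
-- residues modulo α δ also covers those modulo α.
motzkin-divisor : ∀ n α δ → Motzkin n (α *ᵍ δ) → α ≢ 0ᵍ → δ ≢ 0ᵍ → Motzkin n α
motzkin-divisor zero α δ m α≢0 δ≢0 = norm≤1⇒A₀ α (bound (norm α) (norm δ) (norm-positive α α≢0) (norm-positive δ δ≢0)
  (trans (sym (norm-* α δ)) (A₀-norm m (product≢0 α≢0 δ≢0))))
  where
  bound : ∀ s t → 0ℤ < s → 0ℤ < t → s * t ≡ + 1 → s ≤ + 1
  bound s t 0<s 0<t st≡1 = lin 0 (0≤j*k (<⇒≤ 0<s) (i≤j⇒0≤j-i (i<j⇒suc[i]≤j 0<t)) ⊕ ≤-reflexive st≡1) (solve (s ∷ t ∷ []))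
motzkin-divisor (suc n) α δ (inj₁ m) α≢0 δ≢0 = inj₁ (motzkin-divisor n α δ m α≢0 δ≢0)
motzkin-divisor (suc n) α δ (inj₂ cov) α≢0 δ≢0 = inj₂ divisor-cover
  where
  divisor-cover : Motzkin n ↠mod α
  divisor-cover x with m , m∈ , c , e ← cov x = m , m∈ , (δ *ᵍ c) , trans (sym (*ᵍ-assoc α δ c)) e

zero? : ∀ z → z ≡ 0ᵍ ⊎ z ≢ 0ᵍ
zero? (x + y i) with x ≟ 0ℤ | y ≟ 0ℤ
... | yes x≡0 | yes y≡0 = inj₁ (x≡0 ≡ᵍ y≡0)
... | no  x≢0 | _       = inj₂ (x≢0 ∘ cong re)
... | _       | no y≢0  = inj₂ (y≢0 ∘ cong im)

-- Identification of Tₙ with the n-th Motzkin set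

motzkin-zero : ∀ n → Motzkin n 0ᵍ
motzkin-zero zero    = zero∈
motzkin-zero (suc n) = inj₁ (motzkin-zero n)

T-one : T 0 ((+ 1) + (+ 0) i)
T-one = oddᵗ (+ 0 , refl) (octant-octagon (+ 1) (+ 0) ≤-refl (+≤+ ℕ.z≤n) ≤-refl ≤-refl)

T⇒motzkin : ∀ n {z} → T n z → Motzkin n z
T⇒motzkin zero t = T-zero⇒A₀ t
T⇒motzkin (suc n) {z} t = [ (λ { refl → motzkin-zero (suc n) }) , inj₂ ∘ covered ]′ (zero? z)
  where
  covered : z ≢ 0ᵍ → Motzkin n ↠mod z
  covered z≢0 x with r , r∈T , x∼r ← cover n t z≢0 x = r , T⇒motzkin n r∈T , x∼r

-- Here m = γ - (1 + i) γ c = γ (1 - (1 + i) c), and 1 - (1 + i) c is odd.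
half-representative : ∀ γ m → γ ∼ m [ twist γ ] → ∃[ δ ] Odd δ × γ *ᵍ δ ≡ m
half-representative γ@(a + b i) m@(u + v i) (c@(c₁ + c₂ i) , e) = δ , δ-odd , trans (expand a b c₁ c₂) (trans (cong (γ -ᵍ_) e) (minus-minus γ m))
  where
  δ = (+ 1 - (c₁ - c₂)) + (+ 0 - (c₁ + c₂)) i
  δ-odd : Odd δ
  δ-odd = - c₁ , identity c₁ c₂
    where
    identity : ∀ c₁ c₂ → + 1 - (c₁ - c₂) + (+ 0 - (c₁ + c₂)) ≡ - c₁ + - c₁ + + 1
    identity = solve-∀
  expand : ∀ a b c₁ c₂ → (a + b i) *ᵍ ((+ 1 - (c₁ - c₂)) + (+ 0 - (c₁ + c₂)) i) ≡ (a + b i) -ᵍ (twist (a + b i) *ᵍ (c₁ + c₂ i))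
  expand a b c₁ c₂ = real a b c₁ c₂ ≡ᵍ imag a b c₁ c₂
    where
    real : ∀ a b c₁ c₂ → a * (+ 1 - (c₁ - c₂)) - b * (+ 0 - (c₁ + c₂)) ≡ a - ((a - b) * c₁ - (a + b) * c₂)
    real = solve-∀
    imag : ∀ a b c₁ c₂ → a * (+ 0 - (c₁ + c₂)) + b * (+ 1 - (c₁ - c₂)) ≡ b - ((a - b) * c₂ + (a + b) * c₁)
    imag = solve-∀

motzkin⇒T : ∀ n z → Motzkin n z → T n z
motzkin⇒T zero _ zero∈ = zeroᵗ
motzkin⇒T zero _ one∈  = T-one
motzkin⇒T zero _ i∈    = T-rot T-one
motzkin⇒T zero _ mone∈ = T-rot (T-rot T-one)
motzkin⇒T zero _ mi∈   = T-rot (T-rot (T-rot T-one))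
motzkin⇒T (suc n) z (inj₁ m)   = T-suc (motzkin⇒T n z m)
motzkin⇒T (suc n) z (inj₂ cov) = [ z-even , z-odd ]′ (even⊎odd z)
  where
  z-odd : Odd z → T (suc n) z
  z-odd o = oddᵗ o (oct-cover⇒oct {q n} {p n} z o oct-cover)
    where
    oct-cover : OctCover (q n) (p n) z
    oct-cover x with r , r∈ , x∼r ← cov x = r , T⇒oct (motzkin⇒T n r r∈) , x∼r
  z-even : Even z → T (suc n) z
  z-even ev with γ , refl ← untwist z ev = [ (λ { refl → zeroᵗ }) , nonzero ]′ (zero? γ)
    where
    nonzero : γ ≢ 0ᵍ → T (suc n) (twist γ)
    -- An odd factor is nonzero, so `motzkin-divisor` applies to the representative of γ.
    nonzero γ≢0 with m , m∈ , γ∼m ← cov γ with δ , δ-odd , e ← half-representative γ m γ∼m =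
      twistᵗ (motzkin⇒T n γ (motzkin-divisor n γ δ (subst (Motzkin n) (sym e) m∈) γ≢0 (odd≢0 δ δ-odd)))

-- Exact levels

octagon? : ∀ m s x y → Dec (Octagon m s x y)
octagon? m s x y = map′
  (λ { (h₁ , h₂ , h₃ , h₄ , h₅ , h₆ , h₇ , h₈) → octagon h₁ h₂ h₃ h₄ h₅ h₆ h₇ h₈ })
  (λ { (octagon h₁ h₂ h₃ h₄ h₅ h₆ h₇ h₈) → h₁ , h₂ , h₃ , h₄ , h₅ , h₆ , h₇ , h₈ })
  (x ≤? m ×-dec - x ≤? m ×-dec y ≤? m ×-dec - y ≤? m ×-dec
   x + y ≤? s ×-dec x - y ≤? s ×-dec - x + y ≤? s ×-dec - x - y ≤? s)

oct? : ∀ q p z → Dec (Oct q p z)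
oct? q p (x + y i) = octagon? (q + p + p - + 2) (q + q + p + p - + 3) x y

-- The sets Tₙ increase, so only the preceding level has to be excluded. The equation makes the
-- condition vacuous at level 0.
NotBefore : ℕ → ℤ[i] → Set
NotBefore n z = ∀ k → n ≡ suc k → ¬ T k z

Exact : ℕ → ℤ[i] → Set
Exact n z = z ≢ 0ᵍ × T n z × NotBefore n z

T-≤ : ∀ {m n z} → m ℕ.≤ n → T m z → T n z
T-≤ m≤n = go (ℕP.≤⇒≤′ m≤n)
  where
  go : ∀ {m n z} → m ℕ.≤′ n → T m z → T n z
  go (ℕ.≤′-reflexive refl) t = t
  go (ℕ.≤′-step m≤n)       t = T-suc (go m≤n t)

φ⇒exact : ∀ n z → φ≡ z n → Exact n z
φ⇒exact n z (z≢0 , m , before) = z≢0 , motzkin⇒T n z m , λ { k refl t → before k ℕP.≤-refl (T⇒motzkin k t) }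

exact⇒φ : ∀ n z → Exact n z → φ≡ z n
exact⇒φ n z (z≢0 , t , not-before) = z≢0 , T⇒motzkin n t , before n not-before
  where
  before : ∀ n → NotBefore n z → ∀ j → j ℕ.< n → ¬ Motzkin j z
  before (suc n) not-before j (ℕ.s≤s j≤n) m = not-before n refl (T-≤ j≤n (motzkin⇒T j z m))

twist-injective : ∀ z w → twist z ≡ twist w → z ≡ w
twist-injective (a + b i) (c + d i) e = ≤-antisym a≤c c≤a ≡ᵍ ≤-antisym b≤d d≤b
  where
  e₁ : a - b ≡ c - d
  e₁ = cong re e
  e₂ : a + b ≡ c + d
  e₂ = cong im e
  a≤c : a ≤ c
  a≤c = lin₂ 1 (≤-reflexive e₁ ⊕ ≤-reflexive e₂) (solve (a ∷ b ∷ c ∷ d ∷ []))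
  c≤a : c ≤ a
  c≤a = lin₂ 1 (≤-reflexive (sym e₁) ⊕ ≤-reflexive (sym e₂)) (solve (a ∷ b ∷ c ∷ d ∷ []))
  b≤d : b ≤ d
  b≤d = lin₂ 1 (≤-reflexive (sym e₁) ⊕ ≤-reflexive e₂) (solve (a ∷ b ∷ c ∷ d ∷ []))
  d≤b : d ≤ b
  d≤b = lin₂ 1 (≤-reflexive e₁ ⊕ ≤-reflexive (sym e₂)) (solve (a ∷ b ∷ c ∷ d ∷ []))

twist≢0 : ∀ {z} → z ≢ 0ᵍ → twist z ≢ 0ᵍ
twist≢0 {z} z≢0 e = z≢0 (twist-injective z 0ᵍ e)

-- A nonzero multiple of 1 + i is not odd, so only `twistᵗ` can produce it.
untwist-T : ∀ {n z w} → T n z → z ≡ twist w → w ≢ 0ᵍ → ∃[ k ] n ≡ suc k × T k w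
untwist-T {w = w} zeroᵗ e w≢0 = ⊥-elim (twist≢0 w≢0 (sym e))
untwist-T {w = w} (oddᵗ {z = z} o _) e w≢0 = ⊥-elim (¬even×odd {z} (subst Even (sym e) (twist-even w)) o)
untwist-T {w = w} (twistᵗ {n} {z} t) e w≢0 = n , refl , subst (T n) (twist-injective z w e) t

-- An odd point of exact level m ≤ n is moved to exact level n by n - m factors 1 + i.
lift : ℕ → ℤ[i] → ℤ[i]
lift zero    z = z
lift (suc n) z = if does (oct? (q n) (p n) z) then twist (lift n z) else z

lift-inside : ∀ n z → Oct (q n) (p n) z → lift (suc n) z ≡ twist (lift n z)
lift-inside n z o = cong (λ b → if b then twist (lift n z) else z) (dec-true (oct? (q n) (p n) z) o)

lift-outside : ∀ n z → ¬ Oct (q n) (p n) z → lift (suc n) z ≡ z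
lift-outside n z ¬o = cong (λ b → if b then twist (lift n z) else z) (dec-false (oct? (q n) (p n) z) ¬o)

inside⊎outside : ∀ n z → Oct (q n) (p n) z ⊎ ¬ Oct (q n) (p n) z
inside⊎outside n z = toSum (oct? (q n) (p n) z)

-- By `untwist-T`, a factor 1 + i raises the exact level by exactly one. The recursion stops where z
-- leaves the octagon of the preceding level, and there z itself is exact.
lift-exact : ∀ n z → Odd z → Oct (q n) (p n) z → Exact n (lift n z)
lift-exact zero    z z-odd o = odd≢0 z z-odd , oddᵗ z-odd o , λ _ ()
lift-exact (suc n) z z-odd o = [ inside , outside ]′ (inside⊎outside n z)
  where
  inside : Oct (q n) (p n) z → Exact (suc n) (lift (suc n) z)
  inside o′ = subst (Exact (suc n)) (sym (lift-inside n z o′)) (step (lift-exact n z z-odd o′))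
    where
    step : Exact n (lift n z) → Exact (suc n) (twist (lift n z))
    step (w≢0 , t , not-before) = twist≢0 w≢0 , twistᵗ t , λ { k refl t′ → twisted (untwist-T t′ refl w≢0) }
      where
      twisted : ¬ (∃[ k ] n ≡ suc k × T k (lift n z))
      twisted (k , n≡ , t′) = not-before k n≡ t′
  outside : ¬ Oct (q n) (p n) z → Exact (suc n) (lift (suc n) z)
  outside ¬o = subst (Exact (suc n)) (sym (lift-outside n z ¬o))
    (odd≢0 z z-odd , oddᵗ z-odd o , λ { k refl t → ¬o (T⇒oct t) })

exact-lift : ∀ n a → Exact n a → ∃[ z ] Odd z × Oct (q n) (p n) z × lift n z ≡ a
exact-lift n a (a≢0 , zeroᵗ , _) = ⊥-elim (a≢0 refl)
exact-lift zero a (a≢0 , oddᵗ a-odd o , _) = a , a-odd , o , refl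
exact-lift (suc n) a (a≢0 , oddᵗ a-odd o , not-before) =
  a , a-odd , o , lift-outside n a (λ o′ → not-before n refl (oddᵗ a-odd o′))
exact-lift (suc n) _ (a≢0 , twistᵗ {z = w} t , not-before)
  with z , z-odd , o , e ← exact-lift n w ((λ { refl → a≢0 refl }) , t , λ { k refl t′ → not-before n refl (twistᵗ t′) }) =
  z , z-odd , oct-step (admissible n) z o , trans (lift-inside n z o) (cong twist e)

-- A lift with a factor 1 + i is even and one without is odd, so equal lifts come from the same
-- branch.
lift-injective : ∀ n z w → Odd z → Odd w → lift n z ≡ lift n w → z ≡ w
lift-injective zero    z w _ _ e = e
lift-injective (suc n) z w z-odd w-odd e = cases (inside⊎outside n z) (inside⊎outside n w)
  where
  cases : Oct (q n) (p n) z ⊎ ¬ Oct (q n) (p n) z → Oct (q n) (p n) w ⊎ ¬ Oct (q n) (p n) w → z ≡ w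
  cases (inj₁ zᵢ) (inj₁ wᵢ) = lift-injective n z w z-odd w-odd
    (twist-injective (lift n z) (lift n w) (trans (sym (lift-inside n z zᵢ)) (trans e (lift-inside n w wᵢ))))
  cases (inj₂ zₒ) (inj₂ wₒ) = trans (sym (lift-outside n z zₒ)) (trans e (lift-outside n w wₒ))
  cases (inj₁ zᵢ) (inj₂ wₒ) = ⊥-elim (¬even×odd {w}
    (subst Even (trans (sym (lift-inside n z zᵢ)) (trans e (lift-outside n w wₒ))) (twist-even (lift n z))) w-odd)
  cases (inj₂ zₒ) (inj₁ wᵢ) = ⊥-elim (¬even×odd {z}
    (subst Even (trans (sym (lift-inside n w wᵢ)) (trans (sym e) (lift-outside n z zₒ))) (twist-even (lift n w))) z-odd)

-- Odd points in diagonal coordinates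

-- The symmetry v ↦ -1 - v of ℤ exchanges the constructors +_ and -[1+_].
mag : ℤ → ℕ
mag (+ n)    = n
mag -[1+ n ] = n

flip : ℤ → ℤ
flip (+ n)    = -[1+ n ]
flip -[1+ n ] = + n

flip≡ : ∀ v → flip v ≡ - (+ 1 + v)
flip≡ (+ n)        = refl
flip≡ -[1+ zero ]  = refl
flip≡ -[1+ suc n ] = refl

oddPoint : ℤ × ℤ → ℤ[i]
oddPoint (u , v) = (u + v + + 1) + (u - v) i

oddPoint-odd : ∀ c → Odd (oddPoint c)
oddPoint-odd (u , v) = u , identity u v
  where
  identity : ∀ u v → u + v + + 1 + (u - v) ≡ u + u + + 1
  identity = solve-∀

oddPoint-surjective : ∀ z → Odd z → ∃[ c ] oddPoint c ≡ z
oddPoint-surjective (x + y i) (h , e) = (h , h - y) , (trans (real h y) (trans (cong (_- y) (sym e)) (cancel x y)) ≡ᵍ imag h y)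
  where
  real : ∀ h y → h + (h - y) + + 1 ≡ h + h + + 1 - y
  real = solve-∀
  cancel : ∀ x y → x + y - y ≡ x
  cancel = solve-∀
  imag : ∀ h y → h - (h - y) ≡ y
  imag = solve-∀

oddPoint-injective : ∀ c c′ → oddPoint c ≡ oddPoint c′ → c ≡ c′
oddPoint-injective (u , v) (u′ , v′) e = cong₂ _,_ (cong re c≡c′) (trans (sym (neg-involutive v)) (trans (cong -_ (cong im c≡c′)) (neg-involutive v′)))
  where
  c≡c′ : (u + (- v) i) ≡ (u′ + (- v′) i)
  -- `oddPoint (u , v)` is 1 + (1 + i) (u - v i).
  c≡c′ = twist-injective _ _ (shift u v u′ v′ (cong re e) ≡ᵍ cong im e)
    where
    shift : ∀ u v u′ v′ → u + v + + 1 ≡ u′ + v′ + + 1 → u - - v ≡ u′ - - v′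
    shift u v u′ v′ e = trans (drop u v) (trans (cong (_- + 1) e) (sym (drop u′ v′)))
      where
      drop : ∀ u v → u - - v ≡ u + v + + 1 - + 1
      drop = solve-∀

-- `flip` preserves `mag`, so a quarter turn only exchanges the two magnitudes; this reduces all
-- sign patterns to u, v ≥ 0.
rot-oddPoint : ∀ u v → rot (oddPoint (u , v)) ≡ oddPoint (v , flip u)
rot-oddPoint u v = (trans (real u v) (cong (λ w → v + w + + 1) (sym (flip≡ u)))) ≡ᵍ (trans (imag u v) (cong (λ w → v - w) (sym (flip≡ u))))
  where
  real : ∀ u v → - (u - v) ≡ v + - (+ 1 + u) + + 1
  real = solve-∀
  imag : ∀ u v → u + v + + 1 ≡ v - - (+ 1 + u)
  imag = solve-∀

-- For u = m ≥ 0 and v = k ≥ 0, x + y = 2 m + 1 and x - y = 2 k + 1: the diagonal sides bound m and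
-- k separately, and the side x ≤ q + 2 p - 2 cuts off a triangular corner. For q = Q + 1 and p = P
-- the right-hand sides become the natural numbers Q + P and Q + 2 P.
record Fits (q p m k : ℤ) : Set where
  constructor fits
  field
    m<  : m + + 1 ≤ q + p - + 1
    k<  : k + + 1 ≤ q + p - + 1
    m+k : k + (m + + 1) + + 1 ≤ q + p + p - + 1
open Fits

fits⇒octagon : ∀ {q p} m k → 0ℤ ≤ m → 0ℤ ≤ k → Fits q p m k →
               Octagon (q + p + p - + 2) (q + q + p + p - + 3) (m + k + + 1) (m - k)
fits⇒octagon {q} {p} m k 0≤m 0≤k f = record
  { x≤    = lin 0 (m+k f) (solve (m ∷ k ∷ p ∷ q ∷ []))
  ; -x≤   = lin 2 (m+k f ⊕ 0≤m ⊕ 0≤m ⊕ 0≤k ⊕ 0≤k) (solve (m ∷ k ∷ p ∷ q ∷ []))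
  ; y≤    = lin 1 (m+k f ⊕ 0≤k ⊕ 0≤k) (solve (m ∷ k ∷ p ∷ q ∷ []))
  ; -y≤   = lin 1 (m+k f ⊕ 0≤m ⊕ 0≤m) (solve (m ∷ k ∷ p ∷ q ∷ []))
  ; x+y≤  = lin 0 (m< f ⊕ m< f) (solve (m ∷ k ∷ p ∷ q ∷ []))
  ; x-y≤  = lin 0 (k< f ⊕ k< f) (solve (m ∷ k ∷ p ∷ q ∷ []))
  ; -x+y≤ = lin 2 (k< f ⊕ k< f ⊕ 0≤k ⊕ 0≤k ⊕ 0≤k ⊕ 0≤k) (solve (m ∷ k ∷ p ∷ q ∷ []))
  ; -x-y≤ = lin 2 (m< f ⊕ m< f ⊕ 0≤m ⊕ 0≤m ⊕ 0≤m ⊕ 0≤m) (solve (m ∷ k ∷ p ∷ q ∷ [])) }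

octagon⇒fits : ∀ {q p} m k → Octagon (q + p + p - + 2) (q + q + p + p - + 3) (m + k + + 1) (m - k) → Fits q p m k
octagon⇒fits {q} {p} m k o = record
  { m<  = lin₂ 1 (x+y≤ o) (solve (m ∷ k ∷ p ∷ q ∷ []))
  ; k<  = lin₂ 1 (x-y≤ o) (solve (m ∷ k ∷ p ∷ q ∷ []))
  ; m+k = lin 0 (x≤ o) (solve (m ∷ k ∷ p ∷ q ∷ [])) }

fits-swap : ∀ {q p} m k → Fits q p m k → Fits q p k m
fits-swap {q} {p} m k f = record
  { m< = k< f ; k< = m< f ; m+k = lin 0 (m+k f) (solve (m ∷ k ∷ p ∷ q ∷ [])) }

FitsMag : ℤ → ℤ → ℤ → ℤ → Set
FitsMag q p u v = Fits q p (+ mag u) (+ mag v)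

module _ {q p : ℤ} where

  oct-oddPoint-unrot : ∀ u v → Oct q p (oddPoint (v , flip u)) → Oct q p (oddPoint (u , v))
  oct-oddPoint-unrot u v o = unrot-octagon (oddPoint (u , v)) (subst (Oct q p) (sym (rot-oddPoint u v)) o)

  oct-oddPoint-rot : ∀ u v → Oct q p (oddPoint (u , v)) → Oct q p (oddPoint (v , flip u))
  oct-oddPoint-rot u v o = subst (Oct q p) (rot-oddPoint u v) (rot-octagon (oddPoint (u , v)) o)

  fits⇒oct : ∀ u v → FitsMag q p u v → Oct q p (oddPoint (u , v))
  fits⇒oct (+ m) (+ k) f = fits⇒octagon (+ m) (+ k) (+≤+ ℕ.z≤n) (+≤+ ℕ.z≤n) f
  fits⇒oct -[1+ m ] (+ k) f = oct-oddPoint-unrot -[1+ m ] (+ k) (fits⇒oct (+ k) (+ m) (fits-swap (+ m) (+ k) f))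
  fits⇒oct -[1+ m ] -[1+ k ] f = oct-oddPoint-unrot -[1+ m ] -[1+ k ] (oct-oddPoint-unrot -[1+ k ] (+ m) (fits⇒oct (+ m) (+ k) f))
  fits⇒oct (+ m) -[1+ k ] f = oct-oddPoint-unrot (+ m) -[1+ k ] (oct-oddPoint-unrot -[1+ k ] -[1+ m ]
    (oct-oddPoint-unrot -[1+ m ] (+ k) (fits⇒oct (+ k) (+ m) (fits-swap (+ m) (+ k) f))))

  oct⇒fits : ∀ u v → Oct q p (oddPoint (u , v)) → FitsMag q p u v
  oct⇒fits (+ m) (+ k) o = octagon⇒fits (+ m) (+ k) o
  oct⇒fits -[1+ m ] (+ k) o = fits-swap (+ k) (+ m) (oct⇒fits (+ k) (+ m) (oct-oddPoint-rot -[1+ m ] (+ k) o))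
  oct⇒fits -[1+ m ] -[1+ k ] o = oct⇒fits (+ m) (+ k) (oct-oddPoint-rot -[1+ k ] (+ m) (oct-oddPoint-rot -[1+ m ] -[1+ k ] o))
  oct⇒fits (+ m) -[1+ k ] o = fits-swap (+ k) (+ m) (oct⇒fits (+ k) (+ m) (oct-oddPoint-rot -[1+ m ] (+ k)
    (oct-oddPoint-rot -[1+ k ] -[1+ m ] (oct-oddPoint-rot (+ m) -[1+ k ] o))))

-- Enumeration

-- The interval from -n to n - 1, listed from the outside inwards.
segment : ℕ → List ℤ
segment zero    = []
segment (suc n) = + n ∷ -[1+ n ] ∷ segment n

∈-segment⁺ : ∀ n v → mag v ℕ.< n → v ∈ segment n
∈-segment⁺ (suc n) v (ℕ.s≤s v≤n) with ℕP.m≤n⇒m<n∨m≡n v≤n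
∈-segment⁺ (suc n) v _            | inj₁ v<n  = there (there (∈-segment⁺ n v v<n))
∈-segment⁺ (suc n) (+ .n) _       | inj₂ refl = here refl
∈-segment⁺ (suc n) -[1+ .n ] _    | inj₂ refl = there (here refl)

∈-segment⁻ : ∀ n v → v ∈ segment n → mag v ℕ.< n
∈-segment⁻ (suc n) v (here refl)         = ℕP.n<1+n n
∈-segment⁻ (suc n) v (there (here refl)) = ℕP.n<1+n n
∈-segment⁻ (suc n) v (there (there v∈))  = ℕP.m<n⇒m<1+n (∈-segment⁻ n v v∈)

segment-unique : ∀ n → Unique (segment n)
segment-unique zero    = []
segment-unique (suc n) = ((λ ()) All.∷ fresh (+ n) refl) ∷ fresh -[1+ n ] refl ∷ segment-unique n
  where
  fresh : ∀ v → mag v ≡ n → All (v ≢_) (segment n)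
  fresh v v≡n = All.tabulate λ { w∈ refl → ℕP.<-irrefl v≡n (∈-segment⁻ n v w∈) }

row : ℤ → List ℤ → List (ℤ × ℤ)
row u = map (u ,_)

pairs : List ℤ → (ℤ → List ℤ) → List (ℤ × ℤ)
pairs []       f = []
pairs (u ∷ us) f = row u (f u) ++ pairs us f

∈-pairs⁺ : ∀ {us f u v} → u ∈ us → v ∈ f u → (u , v) ∈ pairs us f
∈-pairs⁺ (here refl)         v∈ = ∈-++⁺ˡ (∈-map⁺ _ v∈)
∈-pairs⁺ {u ∷ us} {f} (there u∈) v∈ = ∈-++⁺ʳ (row u (f u)) (∈-pairs⁺ u∈ v∈)

∈-pairs⁻ : ∀ us f {u v} → (u , v) ∈ pairs us f → u ∈ us × v ∈ f u
∈-pairs⁻ (u ∷ us) f uv∈ with ∈-++⁻ (row u (f u)) uv∈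
... | inj₁ uv∈row with _ , v∈ , refl ← ∈-map⁻ (u ,_) uv∈row = here refl , v∈
... | inj₂ uv∈rest with u∈ , v∈ ← ∈-pairs⁻ us f uv∈rest = there u∈ , v∈

pairs-unique : ∀ {us f} → Unique us → (∀ u → Unique (f u)) → Unique (pairs us f)
pairs-unique {[]}     []       _ = []
pairs-unique {u ∷ us} {f} (u∉ ∷ us!) f! = ++⁺ (map⁺ (cong proj₂) (f! u)) (pairs-unique us! f!) disjoint
  where
  disjoint : ∀ {c} → ¬ (c ∈ row u (f u) × c ∈ pairs us f)
  disjoint (c∈row , c∈rest) with _ , _ , refl ← ∈-map⁻ (u ,_) c∈row =
    All.lookup u∉ (proj₁ (∈-pairs⁻ us f c∈rest)) refl

-- Here q = Q + 1 and p = P.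
rowLength : ℕ → ℕ → ℕ → ℕ
rowLength Q P m = (Q ℕ.+ P) ℕ.⊓ ((Q ℕ.+ P ℕ.+ P) ℕ.∸ suc m)

coordinates : ℕ → ℕ → List (ℤ × ℤ)
coordinates Q P = pairs (segment (Q ℕ.+ P)) (λ u → segment (rowLength Q P (mag u)))

coordinates-unique : ∀ Q P → Unique (coordinates Q P)
coordinates-unique Q P = pairs-unique (segment-unique (Q ℕ.+ P)) (λ u → segment-unique (rowLength Q P (mag u)))

<∸⇒+< : ∀ k n m → k ℕ.< n ℕ.∸ m → k ℕ.+ m ℕ.< n
<∸⇒+< k n       zero    k<   = subst (ℕ._< n) (sym (ℕP.+-identityʳ k)) k<
<∸⇒+< k (suc n) (suc m) k<   = subst (ℕ._< suc n) (sym (ℕP.+-suc k m)) (ℕ.s≤s (<∸⇒+< k n m k<))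

+-<⇒<∸ : ∀ k n m → k ℕ.+ m ℕ.< n → k ℕ.< n ℕ.∸ m
+-<⇒<∸ k n m k+m<n = ℕP.m+n≤o⇒m≤o∸n (suc k) k+m<n

<⇒ℤ : ∀ {m n} → m ℕ.< n → + m + + 1 ≤ + n
<⇒ℤ {m} {n} m<n = +≤+ (subst (ℕ._≤ n) (ℕP.+-comm 1 m) m<n)

ℤ⇒< : ∀ {m n} → + m + + 1 ≤ + n → m ℕ.< n
ℤ⇒< {m} {n} (+≤+ m+1≤n) = subst (ℕ._≤ n) (ℕP.+-comm m 1) m+1≤n

∈-coordinates⁺ : ∀ Q P u v → FitsMag (+ suc Q) (+ P) u v → (u , v) ∈ coordinates Q P
∈-coordinates⁺ Q P u v f = ∈-pairs⁺ (∈-segment⁺ (Q ℕ.+ P) u (ℤ⇒< (m< f)))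
  (∈-segment⁺ (rowLength Q P (mag u)) v (ℕP.⊓-pres-m< (ℤ⇒< (k< f))
    (+-<⇒<∸ (mag v) (Q ℕ.+ P ℕ.+ P) (suc (mag u)) (subst (λ m → mag v ℕ.+ m ℕ.< Q ℕ.+ P ℕ.+ P) (ℕP.+-comm (mag u) 1) (ℤ⇒< (m+k f))))))

∈-coordinates⁻ : ∀ Q P u v → (u , v) ∈ coordinates Q P → FitsMag (+ suc Q) (+ P) u v
∈-coordinates⁻ Q P u v uv∈ with u∈ , v∈ ← ∈-pairs⁻ (segment (Q ℕ.+ P)) (λ u → segment (rowLength Q P (mag u))) uv∈ = record
  { m<  = <⇒ℤ (∈-segment⁻ (Q ℕ.+ P) u u∈)
  ; k<  = <⇒ℤ (ℕP.m<n⊓o⇒m<n _ _ v<)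
  ; m+k = <⇒ℤ (subst (λ m → mag v ℕ.+ m ℕ.< Q ℕ.+ P ℕ.+ P) (ℕP.+-comm 1 (mag u))
            (<∸⇒+< (mag v) (Q ℕ.+ P ℕ.+ P) (suc (mag u)) (ℕP.m<n⊓o⇒m<o (Q ℕ.+ P) _ v<))) }
  where
  v< : mag v ℕ.< rowLength Q P (mag u)
  v< = ∈-segment⁻ (rowLength Q P (mag u)) v v∈

partialSum : (ℕ → ℕ) → ℕ → ℕ
partialSum ℓ zero    = 0
partialSum ℓ (suc n) = ℓ n ℕ.+ partialSum ℓ n

length-segment : ∀ n → length (segment n) ≡ n ℕ.+ n
length-segment zero    = refl
length-segment (suc n) = cong suc (trans (cong suc (length-segment n)) (sym (ℕP.+-suc n n)))

-- The factor 4 arises because each magnitude m belongs to two values of u, and each of their rows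
-- has 2 `ℓ m` entries.
length-pairs : ∀ (ℓ : ℕ → ℕ) n → length (pairs (segment n) (λ u → segment (ℓ (mag u)))) ≡ 4 ℕ.* partialSum ℓ n
length-pairs ℓ zero    = refl
length-pairs ℓ (suc n) = begin
  length (row (+ n) vs ++ row -[1+ n ] vs ++ rest)
    ≡⟨ length-++ (row (+ n) vs) ⟩
  length (row (+ n) vs) ℕ.+ length (row -[1+ n ] vs ++ rest)
    ≡⟨ cong₂ ℕ._+_ (length-row (+ n)) (length-++ (row -[1+ n ] vs)) ⟩
  ℓ n ℕ.+ ℓ n ℕ.+ (length (row -[1+ n ] vs) ℕ.+ length rest)
    ≡⟨ cong (ℓ n ℕ.+ ℓ n ℕ.+_) (cong₂ ℕ._+_ (length-row -[1+ n ]) (length-pairs ℓ n)) ⟩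
  ℓ n ℕ.+ ℓ n ℕ.+ (ℓ n ℕ.+ ℓ n ℕ.+ 4 ℕ.* partialSum ℓ n)
    ≡⟨ collect (ℓ n) (partialSum ℓ n) ⟩
  4 ℕ.* partialSum ℓ (suc n) ∎
  where
  open ≡-Reasoning
  vs = segment (ℓ n)
  rest = pairs (segment n) (λ u → segment (ℓ (mag u)))
  length-row : ∀ u → length (row u vs) ≡ ℓ n ℕ.+ ℓ n
  length-row u = trans (length-map (u ,_) vs) (length-segment (ℓ n))
  collect : ∀ l s → l ℕ.+ l ℕ.+ (l ℕ.+ l ℕ.+ 4 ℕ.* s) ≡ 4 ℕ.* (l ℕ.+ s)
  collect l s = ℕ-solve (l ∷ s ∷ [])

-- Rows of magnitude j < P miss the corner, since Q + 2 P - (j + 1) ≥ Q + P.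
short-rows : ∀ Q P m → m ℕ.≤ P → partialSum (rowLength Q P) m ≡ m ℕ.* (Q ℕ.+ P)
short-rows Q P zero    _   = refl
short-rows Q P (suc m) m<P = cong₂ ℕ._+_
  (ℕP.m≤n⇒m⊓n≡m (subst (ℕ._≤ (Q ℕ.+ P ℕ.+ P) ℕ.∸ suc m) (ℕP.m+n∸n≡m (Q ℕ.+ P) P) (ℕP.∸-monoʳ-≤ (Q ℕ.+ P ℕ.+ P) m<P)))
  (short-rows Q P m (ℕP.<⇒≤ m<P))

long-row : ∀ Q P t → t ℕ.< Q → rowLength Q P (t ℕ.+ P) ℕ.+ suc t ≡ Q ℕ.+ P
long-row Q P t t<Q = trans (cong (ℕ._+ suc t) (trans (ℕP.m≥n⇒m⊓n≡n (subst (ℕ._≤ Q ℕ.+ P) (sym row≡) (ℕP.m∸n≤m (Q ℕ.+ P) (suc t)))) row≡))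
  (ℕP.m∸n+n≡m (ℕP.≤-trans t<Q (ℕP.m≤m+n Q P)))
  where
  row≡ : (Q ℕ.+ P ℕ.+ P) ℕ.∸ suc (t ℕ.+ P) ≡ (Q ℕ.+ P) ℕ.∸ suc t
  row≡ = trans (cong₂ ℕ._∸_ (ℕP.+-comm (Q ℕ.+ P) P) (ℕP.+-comm (suc t) P)) (ℕP.[m+n]∸[m+o]≡n∸o P (Q ℕ.+ P) (suc t))

-- Row j + P is shorter than Q + P by j + 1, so the t long rows lack t (t + 1) / 2 in total. Adding
-- this deficit and doubling avoids subtraction and division.
all-rows : ∀ Q P t → t ℕ.≤ Q →
           2 ℕ.* partialSum (rowLength Q P) (t ℕ.+ P) ℕ.+ t ℕ.* suc t ≡ 2 ℕ.* ((t ℕ.+ P) ℕ.* (Q ℕ.+ P))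
all-rows Q P zero _ = trans (ℕP.+-identityʳ _) (cong (2 ℕ.*_) (short-rows Q P P ℕP.≤-refl))
all-rows Q P (suc t) t<Q = begin
  2 ℕ.* (l ℕ.+ s) ℕ.+ suc t ℕ.* suc (suc t)
    ≡⟨ regroup l s t ⟩
  2 ℕ.* (l ℕ.+ suc t) ℕ.+ (2 ℕ.* s ℕ.+ t ℕ.* suc t)
    ≡⟨ cong₂ ℕ._+_ (cong (2 ℕ.*_) (long-row Q P t t<Q)) (all-rows Q P t (ℕP.<⇒≤ t<Q)) ⟩
  2 ℕ.* (Q ℕ.+ P) ℕ.+ 2 ℕ.* ((t ℕ.+ P) ℕ.* (Q ℕ.+ P))
    ≡⟨ ℕP.*-distribˡ-+ 2 (Q ℕ.+ P) _ ⟨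
  2 ℕ.* ((suc t ℕ.+ P) ℕ.* (Q ℕ.+ P)) ∎
  where
  open ≡-Reasoning
  l = rowLength Q P (t ℕ.+ P)
  s = partialSum (rowLength Q P) (t ℕ.+ P)
  regroup : ∀ l s t → 2 ℕ.* (l ℕ.+ s) ℕ.+ (1 ℕ.+ t) ℕ.* (2 ℕ.+ t) ≡ 2 ℕ.* (l ℕ.+ (1 ℕ.+ t)) ℕ.+ (2 ℕ.* s ℕ.+ t ℕ.* (1 ℕ.+ t))
  regroup l s t = ℕ-solve (l ∷ s ∷ t ∷ [])

coordinates-count : ∀ Q P → length (coordinates Q P) ℕ.+ 2 ℕ.* (Q ℕ.* suc Q) ≡ 4 ℕ.* ((Q ℕ.+ P) ℕ.* (Q ℕ.+ P))
coordinates-count Q P = begin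
  length (coordinates Q P) ℕ.+ 2 ℕ.* (Q ℕ.* suc Q)
    ≡⟨ cong (ℕ._+ 2 ℕ.* (Q ℕ.* suc Q)) (length-pairs (rowLength Q P) (Q ℕ.+ P)) ⟩
  4 ℕ.* s ℕ.+ 2 ℕ.* (Q ℕ.* suc Q)
    ≡⟨ double s (Q ℕ.* suc Q) ⟩
  2 ℕ.* (2 ℕ.* s ℕ.+ Q ℕ.* suc Q)
    ≡⟨ cong (2 ℕ.*_) (all-rows Q P Q ℕP.≤-refl) ⟩
  2 ℕ.* (2 ℕ.* ((Q ℕ.+ P) ℕ.* (Q ℕ.+ P)))
    ≡⟨ ℕP.*-assoc 2 2 ((Q ℕ.+ P) ℕ.* (Q ℕ.+ P)) ⟨
  4 ℕ.* ((Q ℕ.+ P) ℕ.* (Q ℕ.+ P)) ∎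
  where
  open ≡-Reasoning
  s = partialSum (rowLength Q P) (Q ℕ.+ P)
  double : ∀ s t → 4 ℕ.* s ℕ.+ 2 ℕ.* t ≡ 2 ℕ.* (2 ℕ.* s ℕ.+ t)
  double s t = ℕ-solve (s ∷ t ∷ [])

coordinates-countℤ : ∀ Q P → + length (coordinates Q P) + + 2 * (+ Q * + suc Q) ≡ + 4 * ((+ Q + + P) * (+ Q + + P))
coordinates-countℤ Q P = begin
  + length (coordinates Q P) + + 2 * (+ Q * + suc Q)
    ≡⟨ cong (λ t → + length (coordinates Q P) + t) (trans (cong (+ 2 *_) (sym (pos-* Q (suc Q)))) (sym (pos-* 2 (Q ℕ.* suc Q)))) ⟩
  + (length (coordinates Q P) ℕ.+ 2 ℕ.* (Q ℕ.* suc Q))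
    ≡⟨ cong +_ (coordinates-count Q P) ⟩
  + (4 ℕ.* ((Q ℕ.+ P) ℕ.* (Q ℕ.+ P)))
    ≡⟨ trans (pos-* 4 ((Q ℕ.+ P) ℕ.* (Q ℕ.+ P))) (cong (+ 4 *_) (pos-* (Q ℕ.+ P) (Q ℕ.+ P))) ⟩
  + 4 * ((+ Q + + P) * (+ Q + + P)) ∎
  where open ≡-Reasoning

-- Cardinality of the preimages

level-card : ∀ n Q P → q n ≡ + suc Q → p n ≡ + P → HasCard (λ a → φ≡ a n) (length (coordinates Q P))
level-card n Q P q≡ p≡ = map point (coordinates Q P) , map⁺ point-injective (coordinates-unique Q P) ,
  (λ a → sound a , complete a) , length-map point (coordinates Q P)
  where
  point : ℤ × ℤ → ℤ[i]
  point = lift n ∘ oddPoint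
  point-injective : ∀ {c c′} → point c ≡ point c′ → c ≡ c′
  point-injective {c} {c′} e = oddPoint-injective c c′
    (lift-injective n (oddPoint c) (oddPoint c′) (oddPoint-odd c) (oddPoint-odd c′) e)
  sound : ∀ a → a ∈ map point (coordinates Q P) → φ≡ a n
  sound a a∈ with (u , v) , c∈ , refl ← ∈-map⁻ point a∈ =
    exact⇒φ n a (lift-exact n (oddPoint (u , v)) (oddPoint-odd (u , v)) in-oct)
    where
    in-oct : Oct (q n) (p n) (oddPoint (u , v))
    in-oct = subst₂ (λ q p → Oct q p (oddPoint (u , v))) (sym q≡) (sym p≡) (fits⇒oct u v (∈-coordinates⁻ Q P u v c∈))
  complete : ∀ a → φ≡ a n → a ∈ map point (coordinates Q P)
  complete a φ = found (exact-lift n a (φ⇒exact n a φ))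
    where
    found : ∃[ z ] Odd z × Oct (q n) (p n) z × lift n z ≡ a → a ∈ map point (coordinates Q P)
    found (z , z-odd , o , refl) = coordinate (oddPoint-surjective z z-odd)
      where
      coordinate : ∃[ c ] oddPoint c ≡ z → lift n z ∈ map point (coordinates Q P)
      coordinate ((u , v) , refl) = ∈-map⁺ point
        (∈-coordinates⁺ Q P u v (oct⇒fits u v (subst₂ (λ q p → Oct q p (oddPoint (u , v))) q≡ p≡ o)))

-- A square of side 2 (q + p - 1) loses four triangles of (q - 1) q / 2 points each.
preimage-card : ∀ n → ∃[ m ] HasCard (λ a → φ≡ a n) m ×
                + m + + 2 * ((q n - + 1) * q n) ≡ + 4 * ((q n - + 1 + p n) * (q n - + 1 + p n))
preimage-card n = go (q n) (p n) refl refl (≤-trans (1≤p (admissible n)) (p≤q (admissible n))) (1≤p (admissible n))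
  where
  go : ∀ q′ p′ → q n ≡ q′ → p n ≡ p′ → + 1 ≤ q′ → + 1 ≤ p′ → ∃[ m ] HasCard (λ a → φ≡ a n) m ×
       + m + + 2 * ((q n - + 1) * q n) ≡ + 4 * ((q n - + 1 + p n) * (q n - + 1 + p n))
  go (+ suc Q) (+ P) q≡ p≡ _ _ = length (coordinates Q P) , level-card n Q P q≡ p≡ ,
    subst₂ (λ q p → + length (coordinates Q P) + + 2 * ((q - + 1) * q) ≡ + 4 * ((q - + 1 + p) * (q - + 1 + p)))
      (sym q≡) (sym p≡) (coordinates-countℤ Q P)
  go (+ 0) _ _ _ (+≤+ ()) _

-- Two steps lead from (q, p) through (2 p, q) to (2 q, 2 p), doubling both parameters.
level-2k : ∀ k → q (2 ℕ.* k) ≡ (+ 2) ^ k × p (2 ℕ.* k) ≡ (+ 2) ^ k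
level-2k zero    = refl , refl
level-2k (suc k) with q≡ , p≡ ← level-2k k =
  trans (cong q (ℕP.*-suc 2 k)) (double q≡) , trans (cong p (ℕP.*-suc 2 k)) (double p≡)
  where
  double : ∀ {j x} → j ≡ x → j + j ≡ + 2 * x
  double {x = x} refl = solve (x ∷ [])

4^k : ∀ k → (+ 4) ^ k ≡ (+ 2) ^ k * (+ 2) ^ k
4^k zero    = refl
4^k (suc k) = trans (cong (+ 4 *_) (4^k k)) (regroup ((+ 2) ^ k))
  where
  regroup : ∀ x → + 4 * (x * x) ≡ + 2 * x * (+ 2 * x)
  regroup = solve-∀

even-level : ∀ x y m → y ≡ x * x → m + + 2 * ((x - + 1) * x) ≡ + 4 * ((x - + 1 + x) * (x - + 1 + x)) →
             m ≡ + 14 * y - + 14 * x + + 4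
even-level x _ m refl e = trans (isolate m x) (trans (cong (_- + 2 * ((x - + 1) * x)) e) (expand x))
  where
  isolate : ∀ m x → m ≡ m + + 2 * ((x - + 1) * x) - + 2 * ((x - + 1) * x)
  isolate = solve-∀
  expand : ∀ x → + 4 * ((x - + 1 + x) * (x - + 1 + x)) - + 2 * ((x - + 1) * x) ≡ + 14 * (x * x) - + 14 * x + + 4
  expand = solve-∀

odd-level : ∀ x y m → y ≡ x * x →
            m + + 2 * ((x + x - + 1) * (x + x)) ≡ + 4 * ((x + x - + 1 + x) * (x + x - + 1 + x)) →
            m ≡ + 28 * y - + 20 * x + + 4
odd-level x _ m refl e = trans (isolate m x) (trans (cong (_- + 2 * ((x + x - + 1) * (x + x))) e) (expand x))
  where
  isolate : ∀ m x → m ≡ m + + 2 * ((x + x - + 1) * (x + x)) - + 2 * ((x + x - + 1) * (x + x))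
  isolate = solve-∀
  expand : ∀ x → + 4 * ((x + x - + 1 + x) * (x + x - + 1 + x)) - + 2 * ((x + x - + 1) * (x + x)) ≡
           + 28 * (x * x) - + 20 * x + + 4
  expand = solve-∀

theorem1p4 : ∀ (k : ℕ) → 1 ℕ.≤ k →
    PreimageCard (2 ℕ.* k) ((+ 14) * ((+ 4) ^ k) - (+ 14) * ((+ 2) ^ k) + (+ 4))
    × PreimageCard (2 ℕ.* k ℕ.+ 1) ((+ 28) * ((+ 4) ^ k) - (+ 20) * ((+ 2) ^ k) + (+ 4))
theorem1p4 k _ = even-case (preimage-card (2 ℕ.* k)) ,
  subst (λ n → PreimageCard n ((+ 28) * ((+ 4) ^ k) - (+ 20) * ((+ 2) ^ k) + (+ 4))) (ℕP.+-comm 1 (2 ℕ.* k))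
    (odd-case (preimage-card (suc (2 ℕ.* k))))
  where
  x = (+ 2) ^ k
  q≡ = proj₁ (level-2k k)
  p≡ = proj₂ (level-2k k)
  even-case : (∃[ m ] HasCard (λ a → φ≡ a (2 ℕ.* k)) m ×
                + m + + 2 * ((q (2 ℕ.* k) - + 1) * q (2 ℕ.* k)) ≡
                + 4 * ((q (2 ℕ.* k) - + 1 + p (2 ℕ.* k)) * (q (2 ℕ.* k) - + 1 + p (2 ℕ.* k)))) →
              PreimageCard (2 ℕ.* k) ((+ 14) * ((+ 4) ^ k) - (+ 14) * ((+ 2) ^ k) + (+ 4))
  even-case (m , card , e) = m , card , even-level x ((+ 4) ^ k) (+ m) (4^k k)
    (subst₂ (λ q p → + m + + 2 * ((q - + 1) * q) ≡ + 4 * ((q - + 1 + p) * (q - + 1 + p))) q≡ p≡ e)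
  -- One more step of the recursion gives q = 2 · 2ᵏ and p = 2ᵏ.
  odd-case : (∃[ m ] HasCard (λ a → φ≡ a (suc (2 ℕ.* k))) m ×
               + m + + 2 * ((p (2 ℕ.* k) + p (2 ℕ.* k) - + 1) * (p (2 ℕ.* k) + p (2 ℕ.* k))) ≡
               + 4 * ((p (2 ℕ.* k) + p (2 ℕ.* k) - + 1 + q (2 ℕ.* k)) * (p (2 ℕ.* k) + p (2 ℕ.* k) - + 1 + q (2 ℕ.* k)))) →
             PreimageCard (suc (2 ℕ.* k)) ((+ 28) * ((+ 4) ^ k) - (+ 20) * ((+ 2) ^ k) + (+ 4))
  odd-case (m , card , e) = m , card , odd-level x ((+ 4) ^ k) (+ m) (4^k k)
    (subst₂ (λ q p → + m + + 2 * ((p + p - + 1) * (p + p)) ≡ + 4 * ((p + p - + 1 + q) * (p + p - + 1 + q))) q≡ p≡ e)
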